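{- For every fixed integer $K\geq 3$ there exists a constant $C$ such that $s(G)\leq K$ for every graph $G$ of order $n\geq 2$ with minimum degree $$\delta(G)\geq \left(\frac{1}{K-1}+\frac{C}{\left(\frac{n}{\ln n}\right)^{1/6}}\right)n.$$
   Context: All graphs are finite and simple. For a graph $G=(V,E)$ and a positive integer $k$, a $k$-weighting is a map $\omega:E\to\{1,2,\ldots,k\}$; the weighted degree of a vertex $v$ is $\sigma_\omega(v)=\sum_{u\in N(v)}\omega(uv)$, where $N(v)$ is the set of neighbours of $v$. The irregularity strength $s(G)$ is the least $k$ such that there exists a $k$-weighting of $G$ for which all vertices have pairwise distinct weighted degrees; if no such $k$ exists (which happens exactly when $G$ has an isolated edge or more than one isolated vertex), $s(G)=+\infty$. Here $\delta(G)$ denotes the minimum degree of $G$ and $\ln$ is the natural logarithm. -}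

module Defs where

open import Data.Nat using (ℕ; zero; suc; _+_; _*_; _∸_; _^_; _≤_; _⊓_; _!)
open import Data.Fin using (Fin; zero; suc)
open import Data.Bool using (Bool; true; false; if_then_else_)
open import Data.Product using (∃; _×_)
open import Relation.Binary.PropositionalEquality using (_≡_)

sumFin : {n : ℕ} → (Fin n → ℕ) → ℕ
sumFin {zero}  f = 0
sumFin {suc n} f = f zero + sumFin (λ i → f (suc i))

-- Minimum of f(i) over i ∈ Fin n (0 by convention on the empty vertex set).
minFin : {n : ℕ} → (Fin n → ℕ) → ℕ
minFin {zero}        f = 0
minFin {suc zero}    f = f zero
minFin {suc (suc n)} f = f zero ⊓ minFin (λ i → f (suc i))

record Graph (n : ℕ) : Set where
  field
    adj    : Fin n → Fin n → Bool
    sym    : ∀ u v → adj u v ≡ adj v u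
    irrefl : ∀ v → adj v v ≡ false
open Graph public

degree : {n : ℕ} → Graph n → Fin n → ℕ
degree G v = sumFin (λ u → if adj G v u then 1 else 0)

minDegree : {n : ℕ} → Graph n → ℕ
minDegree G = minFin (degree G)

-- A k-weighting: a weight w u v = w v u ∈ {1,…,k} on every edge uv
-- (values on non-edges are irrelevant and never used).
record Weighting {n : ℕ} (G : Graph n) (k : ℕ) : Set where
  field
    w       : Fin n → Fin n → ℕ
    w-sym   : ∀ u v → adj G u v ≡ true → w u v ≡ w v u
    w-range : ∀ u v → adj G u v ≡ true → 1 ≤ w u v × w u v ≤ k
open Weighting public

wdeg : {n : ℕ} {G : Graph n} {k : ℕ} → Weighting G k → Fin n → ℕ
wdeg {G = G} ω v = sumFin (λ u → if adj G v u then w ω v u else 0)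

IrrStrengthAtMost : {n : ℕ} → Graph n → ℕ → Set
IrrStrengthAtMost G k =
  ∃ λ (ω : Weighting G k) → ∀ u v → wdeg ω u ≡ wdeg ω v → u ≡ v

-- expSeriesScaled p N = N! * Σ_{j=0}^{N} p^j / j!   (a natural number)
expSeriesScaled : ℕ → ℕ → ℕ
expSeriesScaled p zero    = 1
expSeriesScaled p (suc N) = suc N * expSeriesScaled p N + p ^ suc N

-- m ≤ e^p  (for naturals m, p): some partial sum of the exponential series
-- reaches m.  (Exact, since partial sums increase strictly to e^p and e^p
-- is not an integer for p ≥ 1, while for p = 0 the N = 0 sum is 1 = e^0.)
LeExp : ℕ → ℕ → Set
LeExp m p = ∃ λ N → m * (N !) ≤ expSeriesScaled p N

-- The degree hypothesis of the theorem, for K ≥ 3, C ≥ 0, n ≥ 2: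
--   δ ≥ (1/(K-1) + C / (n / ln n)^(1/6)) · n
-- which is equivalent to
--   a := δ(K-1) - n ≥ 0   and   a^6 ≥ ((K-1)C)^6 · n^5 · ln n,
-- i.e. n ≤ δ(K-1) and n^(((K-1)C)^6 · n^5) ≤ e^(a^6).
MinDegreeCondition : (K C n δ : ℕ) → Set
MinDegreeCondition K C n δ =
  n ≤ δ * (K ∸ 1) ×
  LeExp (n ^ (((K ∸ 1) * C) ^ 6 * n ^ 5)) ((δ * (K ∸ 1) ∸ n) ^ 6)

{-# OPTIONS --safe #-}
-- Write D = K − 1, w = 1 + w′ with w′ ∈ {0,…,D}, and let q be of order n / (Dδ − n).  The vertices are
-- split at random into main vertices, about n/(4Dq) relay vertices and about n/(8D²q²) final vertices.
--  * Relay–main edges give the relay vertices the weighted degrees q k, with distinct k.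
--  * Every main vertex u draws a random colour c(u) and the main–main edges uv with c(u) + c(v) ≥ n get w′ = D.
--    As Dδ > n, every block of consecutive integers then receives fewer main vertices than it has members
--    with residue at least 3 modulo q, so that main–final edges with w′ ∈ {0,1} can lift
--    every main vertex to a value of its own in the next block, with residue at least 3.
--  * The final vertices are treated one by one.  A relay vertex may move between q k and q k + 1, so a
--    final vertex can choose among about as many values as it has relay neighbours, and takes an unused one with residue 2.
-- The random choices are derandomised by conditional expectations of exponential moments, with errors of order
-- √(n ln n).  The lift needs blocks no longer than the n/q² final neighbours available, and a block has a share of
-- order 1/q of spare values; the errors have to be below these n/q³ values, which is the exponent 1/6.
module Submission where

open import Defs
open import Data.Bool using (Bool; true; false; if_then_else_; _∧_; not)
open import Data.Bool.Properties using (T-≡; ∧-zeroʳ; not-involutive)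
open import Data.Fin using (Fin; zero; suc; toℕ; fromℕ<)
open import Data.Fin.Properties using (*↔×; +↔⊎; toℕ<n; toℕ-fromℕ<)
open import Data.List using (List; []; length; filter) renaming (_∷_ to _◂_)
open import Data.List.Membership.Propositional using (_∈_; _∉_; lose)
open import Data.List.Membership.Propositional.Properties using (∈-filter⁺)
open import Data.List.Properties using (filter-notAll)
open import Data.List.Relation.Unary.Any using (here; there)
open import Data.Nat
open import Data.Nat.DivMod
open import Data.Nat.Properties
open import Data.List.Membership.DecPropositional _≟_ using (_∈?_)
open import Data.Nat.Tactic.RingSolver using (solve-∀)
open import Data.Product using (∃; _×_; _,_; proj₁; proj₂)
open import Data.Sum using (_⊎_; inj₁; inj₂)
open import Data.Sum.Function.Propositional using (_⊎-↔_)
open import Data.Vec.Functional using (_∷_)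
open import Function using (_∘_)
open import Function.Bundles using (_↔_; Equivalence; Inverse)
open import Function.Properties.Inverse using (↔-refl; ↔-trans)
open import Relation.Binary.PropositionalEquality as ≡
  using (_≡_; _≢_; refl; cong; cong₂; subst; trans)
open import Relation.Nullary using (contradiction; yes; no; ¬?; ofʸ; ofⁿ)

-- Finite sums, indicators and counting.

sum-cong : ∀ {n} {f g : Fin n → ℕ} → (∀ i → f i ≡ g i) → sumFin f ≡ sumFin g
sum-cong {zero}  e = refl
sum-cong {suc n} e = cong₂ _+_ (e zero) (sum-cong (e ∘ suc))

sum-mono : ∀ {n} {f g : Fin n → ℕ} → (∀ i → f i ≤ g i) → sumFin f ≤ sumFin g
sum-mono {zero}  e = z≤n
sum-mono {suc n} e = +-mono-≤ (e zero) (sum-mono (e ∘ suc))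

sum-+ : ∀ {n} (f g : Fin n → ℕ) → sumFin (λ i → f i + g i) ≡ sumFin f + sumFin g
sum-+ {zero}  f g = refl
sum-+ {suc n} f g rewrite sum-+ (f ∘ suc) (g ∘ suc) = interchange (f zero) (g zero) _ _
  where
  interchange : ∀ a b c d → a + b + (c + d) ≡ a + c + (b + d)
  interchange = solve-∀

sum-*ˡ : ∀ {n} k (f : Fin n → ℕ) → sumFin (λ i → k * f i) ≡ k * sumFin f
sum-*ˡ {zero}  k f = ≡.sym (*-zeroʳ k)
sum-*ˡ {suc n} k f rewrite sum-*ˡ k (f ∘ suc) = ≡.sym (*-distribˡ-+ k (f zero) _)

sum-*ʳ : ∀ {n} k (f : Fin n → ℕ) → sumFin (λ i → f i * k) ≡ sumFin f * k
sum-*ʳ k f = trans (sum-cong λ i → *-comm (f i) k) (trans (sum-*ˡ k f) (*-comm k _))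

sum-const : ∀ n k → sumFin {n} (λ _ → k) ≡ n * k
sum-const zero    k = refl
sum-const (suc n) k = cong (k +_) (sum-const n k)

sum-zero : ∀ {n} {f : Fin n → ℕ} → (∀ i → f i ≡ 0) → sumFin f ≡ 0
sum-zero {n} e = trans (sum-cong e) (trans (sum-const n 0) (*-zeroʳ n))

sum-≤-const : ∀ {n k} {f : Fin n → ℕ} → (∀ i → f i ≤ k) → sumFin f ≤ n * k
sum-≤-const {n} {k} e = ≤-trans (sum-mono e) (≤-reflexive (sum-const n k))

sum-swap : ∀ {n m} (f : Fin n → Fin m → ℕ) →
  sumFin (λ i → sumFin (f i)) ≡ sumFin (λ j → sumFin (λ i → f i j))
sum-swap {zero} {m} f = ≡.sym (sum-zero {m} λ _ → refl)
sum-swap {suc n} f rewrite sum-swap (f ∘ suc) = ≡.sym (sum-+ (f zero) _)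

≤-sum : ∀ {n} (f : Fin n → ℕ) i → f i ≤ sumFin f
≤-sum f zero    = m≤m+n _ _
≤-sum f (suc i) = ≤-trans (≤-sum (f ∘ suc) i) (m≤n+m _ _)

𝟙 : Bool → ℕ
𝟙 b = if b then 1 else 0

𝟙≤1 : ∀ b → 𝟙 b ≤ 1
𝟙≤1 true  = ≤-refl
𝟙≤1 false = z≤n

𝟙-∧ : ∀ a b → 𝟙 (a ∧ b) ≡ 𝟙 a * 𝟙 b
𝟙-∧ true  b = ≡.sym (+-identityʳ _)
𝟙-∧ false b = refl

count : ∀ {n} → (Fin n → Bool) → ℕ
count P = sumFin (𝟙 ∘ P)

count≤ : ∀ {n} (P : Fin n → Bool) → count P ≤ n
count≤ {n} P = ≤-trans (sum-≤-const (𝟙≤1 ∘ P)) (≤-reflexive (*-identityʳ n))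

count-product : ∀ {n m} (P : Fin n → Bool) (R : Fin m → Bool) →
  sumFin (λ u → count (λ c → P u ∧ R c)) ≡ count P * count R
count-product P R = trans
  (sum-cong λ u → trans (sum-cong λ c → 𝟙-∧ (P u) (R c)) (sum-*ˡ (𝟙 (P u)) (𝟙 ∘ R)))
  (sum-*ʳ (count R) (𝟙 ∘ P))

-- Derandomisation by conditional expectations.

prodFin : ∀ {n} → (Fin n → ℕ) → ℕ
prodFin {zero}  f = 1
prodFin {suc n} f = f zero * prodFin (f ∘ suc)

minimiser : ∀ {m} (F : Fin (suc m) → ℕ) → ∃ λ c → ∀ i → F c ≤ F i
minimiser {zero}  F = zero , λ { zero → ≤-refl }
minimiser {suc m} F with minimiser (F ∘ suc)
... | c , c-min with ≤-total (F zero) (F (suc c))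
...   | inj₁ z≤ = zero , λ { zero → ≤-refl ; (suc i) → ≤-trans z≤ (c-min i) }

...   | inj₂ ≤z = suc c , λ { zero → ≤z ; (suc i) → c-min i }

below-average : ∀ {m} (F : Fin (suc m) → ℕ) → ∃ λ c → suc m * F c ≤ sumFin F
below-average {m} F with minimiser F
... | c , c-min = c , ≤-trans (≤-reflexive (≡.sym (sum-const (suc m) (F c)))) (sum-mono c-min)

-- The coordinates are fixed one at a time. Coordinate zero takes the value for which the total is
-- least when all later coordinates are averaged; its weight is then absorbed into `h`, and the
-- induction continues on the remaining coordinates. The power of `suc m` clears the denominators of
-- the averages.
conditional-expectations : ∀ {N n m} (wt : Fin N → Fin n → Fin (suc m) → ℕ) (h : Fin N → ℕ) →
  ∃ λ (c : Fin n → Fin (suc m)) →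
    suc m ^ n * sumFin (λ j → h j * prodFin (λ u → wt j u (c u)))
      ≤ sumFin (λ j → h j * prodFin (λ u → sumFin (wt j u)))
conditional-expectations {n = zero}  wt h = (λ ()) , ≤-reflexive (*-identityˡ _)
conditional-expectations {N} {suc n} {m} wt h
  with below-average (λ c₀ → sumFin (λ j → h j * wt j zero c₀ * prodFin (λ u → sumFin (wt j (suc u)))))
... | c₀ , c₀-good
  with conditional-expectations (λ j u → wt j (suc u)) (λ j → h j * wt j zero c₀)
... | c , c-good = (c₀ ∷ c) , (begin
  suc m * suc m ^ n * sumFin (λ j → h j * (wt j zero c₀ * tail j))
    ≡⟨ *-assoc (suc m) (suc m ^ n) _ ⟩
  suc m * (suc m ^ n * sumFin (λ j → h j * (wt j zero c₀ * tail j)))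
    ≡⟨ cong (λ s → suc m * (suc m ^ n * s)) (sum-cong λ j → ≡.sym (*-assoc (h j) _ _)) ⟩
  suc m * (suc m ^ n * sumFin (λ j → h j * wt j zero c₀ * tail j))
    ≤⟨ *-monoʳ-≤ (suc m) c-good ⟩
  suc m * sumFin (λ j → h j * wt j zero c₀ * mean j)
    ≤⟨ c₀-good ⟩
  sumFin (λ c₁ → sumFin (λ j → h j * wt j zero c₁ * mean j))
    ≡⟨ sum-swap (λ c₁ j → h j * wt j zero c₁ * mean j) ⟩
  sumFin (λ j → sumFin (λ c₁ → h j * wt j zero c₁ * mean j))
    ≡⟨ sum-cong (λ j → trans (sum-*ʳ (mean j) (λ c₁ → h j * wt j zero c₁)) (cong (_* mean j) (sum-*ˡ (h j) (wt j zero)))) ⟩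
  sumFin (λ j → h j * sumFin (wt j zero) * mean j)
    ≡⟨ sum-cong (λ j → *-assoc (h j) _ _) ⟩
  sumFin (λ j → h j * (sumFin (wt j zero) * mean j)) ∎)
  where
  open ≤-Reasoning
  tail mean : Fin N → ℕ
  tail j = prodFin (λ u → wt j (suc u) (c u))
  mean j = prodFin (λ u → sumFin (wt j (suc u)))

-- Powers of 1 + 1/Z in place of the exponential function.

bernoulli : ∀ Z p → (Z + p) * Z ^ p ≤ Z * suc Z ^ p
bernoulli Z zero    = ≤-reflexive (cong (_* 1) (+-identityʳ Z))
bernoulli Z (suc p) = begin
  (Z + suc p) * (Z * Z ^ p)             ≤⟨ m≤m+n _ (p * Z ^ p) ⟩
  (Z + suc p) * (Z * Z ^ p) + p * Z ^ p ≡⟨ lemma Z p (Z ^ p) ⟩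
  suc Z * ((Z + p) * Z ^ p)             ≤⟨ *-monoʳ-≤ (suc Z) (bernoulli Z p) ⟩
  suc Z * (Z * suc Z ^ p)               ≡⟨ swap (suc Z) Z (suc Z ^ p) ⟩
  Z * (suc Z * suc Z ^ p)               ∎
  where
  open ≤-Reasoning
  lemma : ∀ Z p x → (Z + suc p) * (Z * x) + p * x ≡ suc Z * ((Z + p) * x)
  lemma = solve-∀
  swap : ∀ a b c → a * (b * c) ≡ b * (a * c)
  swap = solve-∀

-- (1 + 1/Z)^j ≤ 1 / (1 − j/Z)
inverse-bernoulli : ∀ Z j e → j + e ≡ Z → suc Z ^ j * e ≤ Z * Z ^ j
inverse-bernoulli Z zero    e eq rewrite eq = ≤-reflexive (*-comm 1 Z)
inverse-bernoulli Z (suc j) e eq = begin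
  suc Z * suc Z ^ j * e    ≡⟨ rearrange (suc Z) (suc Z ^ j) e ⟩
  suc Z ^ j * (suc Z * e)  ≤⟨ *-monoʳ-≤ (suc Z ^ j) step ⟩
  suc Z ^ j * (Z * suc e)  ≡⟨ rearrange′ (suc Z ^ j) Z (suc e) ⟩
  Z * (suc Z ^ j * suc e)  ≤⟨ *-monoʳ-≤ Z (inverse-bernoulli Z j (suc e) (trans (+-suc j e) eq)) ⟩
  Z * (Z * Z ^ j)          ∎
  where
  open ≤-Reasoning
  rearrange : ∀ a b c → a * b * c ≡ b * (a * c)
  rearrange = solve-∀
  rearrange′ : ∀ a b c → a * (b * c) ≡ b * (a * c)
  rearrange′ = solve-∀
  step : suc Z * e ≤ Z * suc e
  step = begin
    e + Z * e ≤⟨ +-monoˡ-≤ (Z * e) (≤-trans (m≤n+m e (suc j)) (≤-reflexive eq)) ⟩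
    Z + Z * e ≡⟨ *-suc Z e ⟨
    Z * suc e ∎

^-distribʳ-* : ∀ a b k → (a * b) ^ k ≡ a ^ k * b ^ k
^-distribʳ-* a b zero    = refl
^-distribʳ-* a b (suc k) rewrite ^-distribʳ-* a b k = lemma a b (a ^ k) (b ^ k)
  where
  lemma : ∀ a b x y → a * b * (x * y) ≡ a * x * (b * y)
  lemma = solve-∀

-- A logarithm to the base 1 + 1/Z without real numbers: if x exceeded y by d + 1, cancelling the
-- common powers would leave (Z + 1)^(d + 1) ≤ Z^(d + 1).
exponent-≤ : ∀ Z .{{_ : NonZero Z}} x y → suc Z ^ x * Z ^ y ≤ suc Z ^ y * Z ^ x → x ≤ y
exponent-≤ Z x y le with x ≤? y
... | yes x≤y = x≤y
... | no x≰y with m≤n⇒∃[o]m+o≡n (≰⇒> x≰y)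
...   | d , refl = contradiction (<-≤-trans power-< le′) (<-irrefl refl)
  where
  open ≤-Reasoning
  instance
    _ = m^n≢0 Z y
    _ = m^n≢0 (suc Z) y
    _ = m*n≢0 (suc Z ^ y) (Z ^ y)
  split : ∀ A → A ^ suc (y + d) ≡ A ^ y * A ^ suc d
  split A = trans (cong (A ^_) (≡.sym (+-suc y d))) (^-distribˡ-+-* A y (suc d))
  power-< : Z ^ suc d < suc Z ^ suc d
  power-< = ^-monoˡ-< (suc d) (n<1+n Z)
  rearrange₁ : ∀ a b c → a * b * c ≡ (a * c) * b
  rearrange₁ = solve-∀
  le′ : suc Z ^ suc d ≤ Z ^ suc d
  le′ = *-cancelˡ-≤ (suc Z ^ y * Z ^ y) (begin
    suc Z ^ y * Z ^ y * suc Z ^ suc d   ≡⟨ rearrange₁ (suc Z ^ y) (Z ^ y) (suc Z ^ suc d) ⟩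
    suc Z ^ y * suc Z ^ suc d * Z ^ y   ≡⟨ cong (_* Z ^ y) (split (suc Z)) ⟨
    suc Z ^ suc (y + d) * Z ^ y         ≤⟨ le ⟩
    suc Z ^ y * Z ^ suc (y + d)         ≡⟨ cong (suc Z ^ y *_) (split Z) ⟩
    suc Z ^ y * (Z ^ y * Z ^ suc d)     ≡⟨ *-assoc (suc Z ^ y) (Z ^ y) (Z ^ suc d) ⟨
    suc Z ^ y * Z ^ y * Z ^ suc d ∎)

-- Exponential moments and the Chernoff bound.

-- The product is (M + 1)^k M^(n - k) with k = `count P`; the additional factor M^k on the left
-- avoids the subtraction.
prod-weights : ∀ M {n} (P : Fin n → Bool) →
  prodFin (λ u → M + 𝟙 (P u)) * M ^ count P ≡ suc M ^ count P * M ^ n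
prod-weights M {zero}  P = refl
prod-weights M {suc n} P with P zero | prod-weights M (P ∘ suc)
... | true  | ih = trans (lemma M _ _) (trans (cong (suc M * M *_) ih) (lemma′ M (suc M ^ count (P ∘ suc)) (M ^ n)))
  where
  lemma′ : ∀ M x y → suc M * M * (x * y) ≡ suc M * x * (M * y)
  lemma′ = solve-∀
  lemma : ∀ M x y → (M + 1) * x * (M * y) ≡ suc M * M * (x * y)
  lemma = solve-∀
  
... | false | ih = trans (lemma M _ _) (trans (cong (M *_) ih) (lemma′ M (suc M ^ count (P ∘ suc)) (M ^ n)))
  where
  lemma : ∀ M x y → (M + 0) * x * y ≡ M * (x * y)
  lemma = solve-∀
  lemma′ : ∀ M x y → M * (x * y) ≡ x * (M * y)
  lemma′ = solve-∀

module _ (m M : ℕ) .{{_ : NonZero m}} .{{_ : NonZero M}} where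

  private
    Z : ℕ
    Z = m * (M * M)

    instance
      M*M≢0 : NonZero (M * M)
      M*M≢0 = m*n≢0 M M
      Z≢0 : NonZero Z
      Z≢0 = m*n≢0 m (M * M)

  -- If k of m colours are hits, the mean of M + indicator is M (1 + k/(mM)), and k/(mM) = Mk/Z for
  -- Z = mM². Bernoulli then gives a power of 1 + 1/Z with the integer exponent Mk; this is the
  -- reason for the choice of Z.
  mean-factor : ∀ k → (m * M + k) * Z ^ (M * k) ≤ m * M * suc Z ^ (M * k)
  mean-factor k = *-cancelˡ-≤ M (begin
    M * ((m * M + k) * Z ^ (M * k)) ≡⟨ lemma m M k _ ⟩
    (Z + M * k) * Z ^ (M * k)       ≤⟨ bernoulli Z (M * k) ⟩
    Z * suc Z ^ (M * k)             ≡⟨ lemma′ m M _ ⟩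
    M * (m * M * suc Z ^ (M * k))   ∎)
    where
    open ≤-Reasoning
    lemma : ∀ m M k x → M * ((m * M + k) * x) ≡ (m * (M * M) + M * k) * x
    lemma = solve-∀
    lemma′ : ∀ m M x → m * (M * M) * x ≡ M * (m * M * x)
    lemma′ = solve-∀

  mean-product : ∀ {n} (k : Fin n → ℕ) →
    prodFin (λ u → m * M + k u) * Z ^ (M * sumFin k) ≤ (m * M) ^ n * suc Z ^ (M * sumFin k)
  mean-product {zero}  k rewrite *-zeroʳ M = ≤-refl
  mean-product {suc n} k
    rewrite *-distribˡ-+ M (k zero) (sumFin (k ∘ suc))
          | ^-distribˡ-+-* Z (M * k zero) (M * sumFin (k ∘ suc))
          | ^-distribˡ-+-* (suc Z) (M * k zero) (M * sumFin (k ∘ suc)) = begin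
    (m * M + k zero) * Π * (Z ^ p * Z ^ p′)                   ≡⟨ interchange (m * M + k zero) _ _ _ ⟩
    (m * M + k zero) * Z ^ p * (Π * Z ^ p′)                   ≤⟨ *-mono-≤ (mean-factor (k zero)) (mean-product (k ∘ suc)) ⟩
    m * M * suc Z ^ p * ((m * M) ^ n * suc Z ^ p′)            ≡⟨ interchange (m * M) _ _ _ ⟩
    m * M * (m * M) ^ n * (suc Z ^ p * suc Z ^ p′)            ∎
    where
    open ≤-Reasoning
    Π p p′ : ℕ
    Π  = prodFin (λ u → m * M + k (suc u))
    p  = M * k zero
    p′ = M * sumFin (k ∘ suc)
    interchange : ∀ a b c d → a * b * (c * d) ≡ a * c * (b * d)
    interchange = solve-∀

-- With g = 1 + 1/Z, Z = mM² and M = M′ + 1: 1 + 1/M ≥ g ^ (m(M−1)).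
growth-lower : ∀ m M′ → let M = suc M′; Z = m * (M * M) in .{{_ : NonZero m}} →
  suc Z ^ (m * M′) * M ≤ Z ^ (m * M′) * suc M
growth-lower m M′ = *-cancelˡ-≤ Z (begin
  Z * (suc Z ^ j * M)    ≡⟨ swap Z (suc Z ^ j) M ⟩
  -- Here e = Z - j = m(M² - M + 1), and (M² - M + 1)(M + 1) = M³ + 1.
  suc Z ^ j * (Z * M)    ≤⟨ *-monoʳ-≤ (suc Z ^ j) (≤-trans (m≤m+n (Z * M) m) (≤-reflexive (cubes m M′))) ⟩
  suc Z ^ j * (e * suc M) ≡⟨ *-assoc (suc Z ^ j) e (suc M) ⟨
  suc Z ^ j * e * suc M  ≤⟨ *-monoˡ-≤ (suc M) (inverse-bernoulli Z j e (split m M′)) ⟩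
  Z * Z ^ j * suc M      ≡⟨ *-assoc Z (Z ^ j) (suc M) ⟩
  Z * (Z ^ j * suc M)    ∎)
  where
  open ≤-Reasoning
  M Z j e : ℕ
  M = suc M′
  Z = m * (M * M)
  j = m * M′
  e = m * (M * M′ + 1)
  instance
    _ = m*n≢0 m (M * M)
  swap : ∀ a b c → a * (b * c) ≡ b * (a * c)
  swap = solve-∀
  split : ∀ m M′ → m * M′ + m * (suc M′ * M′ + 1) ≡ m * (suc M′ * suc M′)
  split = solve-∀
  cubes : ∀ m M′ → m * (suc M′ * suc M′) * suc M′ + m ≡ m * (suc M′ * M′ + 1) * suc (suc M′)
  cubes = solve-∀

-- Markov's inequality for the sum over j of the exponential moments (1 + 1/M)^count, normalised by their means.
chernoff : ∀ {N n m M l T} .{{_ : NonZero m}} .{{_ : NonZero M}} → N ≤ 2 ^ l → n + l * (M * M) ≤ M * T →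
  (f : Fin N → Fin n → Fin m → Bool) →
  ∃ λ (c : Fin n → Fin m) → ∀ j →
    m * count (λ u → f j u (c u)) ≤ sumFin (λ u → count (f j u)) + m * T
chernoff {N} {n} {m@(suc m′)} {M@(suc M′)} {l} {T} N≤2^l T-large f = c , bound
  where
  open ≤-Reasoning
  Z : ℕ
  Z = m * (M * M)
  k : Fin N → Fin n → ℕ
  k j u = count (f j u)
  μ h : Fin N → ℕ
  μ j = sumFin (k j)
  P : ℕ
  P = M * (n * m)
  -- Up to the common factor (Z + 1)^P this is (1 + 1/Z)^(-M μ j), the reciprocal of the bound that
  -- `mean-product` gives for the mean. `P` exceeds no exponent's need: it bounds every M μ j, so
  -- that the truncated subtraction is exact.
  h j = suc Z ^ (P ∸ M * μ j) * Z ^ (M * μ j)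
  choice = conditional-expectations (λ j u c′ → M + 𝟙 (f j u c′)) h
  c = proj₁ choice
  S prod prod̄ : Fin N → ℕ
  S j = count (λ u → f j u (c u))
  prod j = prodFin (λ u → M + 𝟙 (f j u (c u)))
  prod̄ j = prodFin (λ u → sumFin (λ c′ → M + 𝟙 (f j u c′)))

  instance
    _ = m^n≢0 M n
    _ = m^n≢0 m n

  μ≤ : ∀ j → M * μ j ≤ P
  μ≤ j = *-monoʳ-≤ M (sum-≤-const (λ u → count≤ (f j u)))

  prod-cong : ∀ {n} {f g : Fin n → ℕ} → (∀ i → f i ≡ g i) → prodFin f ≡ prodFin g
  prod-cong {zero}  e = refl
  prod-cong {suc n} e = cong₂ _*_ (e zero) (prod-cong (e ∘ suc))

  term-mean : ∀ j → h j * prod̄ j ≤ (m * M) ^ n * suc Z ^ P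
  term-mean j = begin
    suc Z ^ (P ∸ M * μ j) * Z ^ (M * μ j) * prod̄ j
      ≡⟨ cong (h j *_) (prod-cong λ u → trans (sum-+ (λ _ → M) (𝟙 ∘ f j u)) (cong (_+ k j u) (sum-const m M))) ⟩
    suc Z ^ (P ∸ M * μ j) * Z ^ (M * μ j) * prodFin (λ u → m * M + k j u)
      ≡⟨ rotate (suc Z ^ (P ∸ M * μ j)) (Z ^ (M * μ j)) _ ⟩
    suc Z ^ (P ∸ M * μ j) * (prodFin (λ u → m * M + k j u) * Z ^ (M * μ j))
      ≤⟨ *-monoʳ-≤ (suc Z ^ (P ∸ M * μ j)) (mean-product m M (k j)) ⟩
    suc Z ^ (P ∸ M * μ j) * ((m * M) ^ n * suc Z ^ (M * μ j))
      ≡⟨ swap (suc Z ^ (P ∸ M * μ j)) ((m * M) ^ n) _ ⟩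
    (m * M) ^ n * (suc Z ^ (P ∸ M * μ j) * suc Z ^ (M * μ j))
      ≡⟨ cong ((m * M) ^ n *_) (^-distribˡ-+-* (suc Z) (P ∸ M * μ j) (M * μ j)) ⟨
    (m * M) ^ n * suc Z ^ (P ∸ M * μ j + M * μ j)
      ≡⟨ cong (λ e → (m * M) ^ n * suc Z ^ e) (m∸n+n≡m (μ≤ j)) ⟩
    (m * M) ^ n * suc Z ^ P ∎
    where
    rotate : ∀ a b c → a * b * c ≡ a * (c * b)
    rotate = solve-∀
    swap : ∀ a b c → a * (b * c) ≡ b * (a * c)
    swap = solve-∀

  term-chosen : ∀ j → h j * prod j ≤ N * (M ^ n * suc Z ^ P)
  term-chosen j = *-cancelˡ-≤ (m ^ n) (begin
    m ^ n * (h j * prod j)                          ≤⟨ *-monoʳ-≤ (m ^ n) (≤-sum (λ i → h i * prod i) j) ⟩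
    m ^ n * sumFin (λ i → h i * prod i)             ≤⟨ proj₂ choice ⟩
    sumFin (λ i → h i * prod̄ i)                     ≤⟨ sum-≤-const term-mean ⟩
    N * ((m * M) ^ n * suc Z ^ P)                   ≡⟨ cong (λ x → N * (x * suc Z ^ P)) (^-distribʳ-* m M n) ⟩
    N * (m ^ n * M ^ n * suc Z ^ P)                 ≡⟨ swap N (m ^ n) (M ^ n) _ ⟩
    m ^ n * (N * (M ^ n * suc Z ^ P))               ∎)
    where
    swap : ∀ a b c d → a * (b * c * d) ≡ b * (a * (c * d))
    swap = solve-∀

  exponential-moment : ∀ j → suc M ^ S j * Z ^ (M * μ j) ≤ N * (M ^ S j * suc Z ^ (M * μ j))
  exponential-moment j = *-cancelˡ-≤ (suc Z ^ r * M ^ n) {{m*n≢0 (suc Z ^ r) (M ^ n) {{m^n≢0 (suc Z) r}}}} (begin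
    suc Z ^ r * M ^ n * (suc M ^ S j * Z ^ (M * μ j))
      ≡⟨ lemma (suc Z ^ r) (M ^ n) (suc M ^ S j) _ ⟩
    suc Z ^ r * Z ^ (M * μ j) * (suc M ^ S j * M ^ n)
      ≡⟨ cong (h j *_) (prod-weights M (λ u → f j u (c u))) ⟨
    h j * (prod j * M ^ S j)
      ≡⟨ *-assoc (h j) (prod j) (M ^ S j) ⟨
    h j * prod j * M ^ S j
      ≤⟨ *-monoˡ-≤ (M ^ S j) (term-chosen j) ⟩
    N * (M ^ n * suc Z ^ P) * M ^ S j
      ≡⟨ cong (λ e → N * (M ^ n * suc Z ^ e) * M ^ S j) (m∸n+n≡m (μ≤ j)) ⟨
    N * (M ^ n * suc Z ^ (r + M * μ j)) * M ^ S j
      ≡⟨ cong (λ x → N * (M ^ n * x) * M ^ S j) (^-distribˡ-+-* (suc Z) r (M * μ j)) ⟩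
    N * (M ^ n * (suc Z ^ r * suc Z ^ (M * μ j))) * M ^ S j
      ≡⟨ lemma′ N (M ^ n) (suc Z ^ r) _ _ ⟩
    suc Z ^ r * M ^ n * (N * (M ^ S j * suc Z ^ (M * μ j))) ∎)
    where
    r : ℕ
    r = P ∸ M * μ j
    lemma : ∀ a b c d → a * b * (c * d) ≡ a * d * (c * b)
    lemma = solve-∀
    lemma′ : ∀ a b c d e → a * (b * (c * d)) * e ≡ c * b * (a * (e * d))
    lemma′ = solve-∀

  -- By Bernoulli (1 + 1/Z)^Z ≥ 2, so the factor N ≤ 2^l coming from the number of tests costs l Z
  -- further powers of 1 + 1/Z.
  N-small : N * Z ^ (l * Z) ≤ suc Z ^ (l * Z)
  N-small = begin
    N * Z ^ (l * Z)         ≤⟨ *-monoˡ-≤ (Z ^ (l * Z)) N≤2^l ⟩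
    2 ^ l * Z ^ (l * Z)     ≡⟨ cong (λ e → 2 ^ l * Z ^ e) (*-comm l Z) ⟩
    2 ^ l * Z ^ (Z * l)     ≡⟨ cong (2 ^ l *_) (^-*-assoc Z Z l) ⟨
    2 ^ l * (Z ^ Z) ^ l     ≡⟨ ^-distribʳ-* 2 (Z ^ Z) l ⟨
    (2 * Z ^ Z) ^ l         ≤⟨ ^-monoˡ-≤ l doubling ⟩
    (suc Z ^ Z) ^ l         ≡⟨ ^-*-assoc (suc Z) Z l ⟩
    suc Z ^ (Z * l)         ≡⟨ cong (suc Z ^_) (*-comm Z l) ⟩
    suc Z ^ (l * Z)         ∎
    where
    doubling : 2 * Z ^ Z ≤ suc Z ^ Z
    doubling = *-cancelˡ-≤ Z (begin
      Z * (2 * Z ^ Z)   ≡⟨ lemma Z (Z ^ Z) ⟩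
      (Z + Z) * Z ^ Z   ≤⟨ bernoulli Z Z ⟩
      Z * suc Z ^ Z     ∎)
      where
      lemma : ∀ Z x → Z * (2 * x) ≡ (Z + Z) * x
      lemma = solve-∀

  -- With g = 1 + 1/Z, `growth-lower` replaces 1 + 1/M by g^(m(M - 1)). Both sides of
  -- `exponential-moment` thereby become powers of g, ready for `exponent-≤`.
  powers : ∀ j → suc Z ^ (m * M′ * S j) * Z ^ (M * μ j + l * Z)
               ≤ suc Z ^ (M * μ j + l * Z) * Z ^ (m * M′ * S j)
  powers j = *-cancelˡ-≤ (M ^ s) {{m^n≢0 M s}} (begin
    M ^ s * (suc Z ^ (i * s) * Z ^ (y + l * Z))
      ≡⟨ cong₂ (λ a b → M ^ s * (a * b)) (≡.sym (^-*-assoc (suc Z) i s)) (^-distribˡ-+-* Z y (l * Z)) ⟩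
    M ^ s * ((suc Z ^ i) ^ s * (Z ^ y * Z ^ (l * Z)))
      ≡⟨ lemma₁ (M ^ s) ((suc Z ^ i) ^ s) (Z ^ y) (Z ^ (l * Z)) ⟩
    (suc Z ^ i) ^ s * M ^ s * (Z ^ y * Z ^ (l * Z))
      ≡⟨ cong (_* (Z ^ y * Z ^ (l * Z))) (^-distribʳ-* (suc Z ^ i) M s) ⟨
    (suc Z ^ i * M) ^ s * (Z ^ y * Z ^ (l * Z))
      ≤⟨ *-monoˡ-≤ (Z ^ y * Z ^ (l * Z)) (^-monoˡ-≤ s (growth-lower m M′)) ⟩
    (Z ^ i * suc M) ^ s * (Z ^ y * Z ^ (l * Z))
      ≡⟨ cong (_* (Z ^ y * Z ^ (l * Z))) (^-distribʳ-* (Z ^ i) (suc M) s) ⟩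
    (Z ^ i) ^ s * suc M ^ s * (Z ^ y * Z ^ (l * Z))
      ≡⟨ lemma₂ ((Z ^ i) ^ s) (suc M ^ s) (Z ^ y) _ ⟩
    (Z ^ i) ^ s * Z ^ (l * Z) * (suc M ^ s * Z ^ y)
      ≤⟨ *-monoʳ-≤ ((Z ^ i) ^ s * Z ^ (l * Z)) (exponential-moment j) ⟩
    (Z ^ i) ^ s * Z ^ (l * Z) * (N * (M ^ s * suc Z ^ y))
      ≡⟨ lemma₃ ((Z ^ i) ^ s) (Z ^ (l * Z)) N (M ^ s) _ ⟩
    (Z ^ i) ^ s * (M ^ s * suc Z ^ y) * (N * Z ^ (l * Z))
      ≤⟨ *-monoʳ-≤ ((Z ^ i) ^ s * (M ^ s * suc Z ^ y)) N-small ⟩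
    (Z ^ i) ^ s * (M ^ s * suc Z ^ y) * suc Z ^ (l * Z)
      ≡⟨ lemma₄ ((Z ^ i) ^ s) (M ^ s) (suc Z ^ y) _ ⟩
    M ^ s * (suc Z ^ y * suc Z ^ (l * Z) * (Z ^ i) ^ s)
      ≡⟨ cong₂ (λ a b → M ^ s * (a * b)) (≡.sym (^-distribˡ-+-* (suc Z) y (l * Z))) (^-*-assoc Z i s) ⟩
    M ^ s * (suc Z ^ (y + l * Z) * Z ^ (i * s)) ∎)
    where
    s y i : ℕ
    s = S j
    y = M * μ j
    i = m * M′
    lemma₁ : ∀ a b c d → a * (b * (c * d)) ≡ b * a * (c * d)
    lemma₁ = solve-∀
    lemma₂ : ∀ a b c d → a * b * (c * d) ≡ a * d * (b * c)
    lemma₂ = solve-∀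
    lemma₃ : ∀ a b c d e → a * b * (c * (d * e)) ≡ a * (d * e) * (c * b)
    lemma₃ = solve-∀
    lemma₄ : ∀ a b c d → a * (b * c) * d ≡ b * (c * d * a)
    lemma₄ = solve-∀

  bound : ∀ j → m * S j ≤ μ j + m * T
  bound j = *-cancelˡ-≤ M (begin
    M * (m * S j)                         ≡⟨ lemma₁ M′ m (S j) ⟩
    -- The exponent has M - 1 where M is wanted. The missing m S is at most m n, the source of the
    -- term n in `T-large`; the term l M² pays for the number of tests.
    m * M′ * S j + m * S j                ≤⟨ +-mono-≤ (exponent-≤ Z (m * M′ * S j) (M * μ j + l * Z) (powers j)) (*-monoʳ-≤ m (count≤ (λ u → f j u (c u)))) ⟩
    M * μ j + l * Z + m * n               ≡⟨ lemma₂ M (μ j) l m n ⟩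
    M * μ j + m * (n + l * (M * M))       ≤⟨ +-monoʳ-≤ (M * μ j) (*-monoʳ-≤ m T-large) ⟩
    M * μ j + m * (M * T)                 ≡⟨ lemma₃ M (μ j) m T ⟩
    M * (μ j + m * T)                     ∎)
    where
    lemma₁ : ∀ M′ m s → suc M′ * (m * s) ≡ m * M′ * s + m * s
    lemma₁ = solve-∀
    lemma₂ : ∀ M μ l m n → M * μ + l * (m * (M * M)) + m * n ≡ M * μ + m * (n + l * (M * M))
    lemma₂ = solve-∀
    lemma₃ : ∀ M μ m T → M * μ + m * (M * T) ≡ M * (μ + m * T)
    lemma₃ = solve-∀

-- Prescribed sums, ranks, and counting in intervals and progressions.

-- Greedy from the left: each entry takes as much of the remainder as its capacity allows. All edge
-- weights with a prescribed row sum are obtained from it.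
fill : ∀ {n} (cap : Fin n → ℕ) r → r ≤ sumFin cap →
  ∃ λ (α : Fin n → ℕ) → (∀ i → α i ≤ cap i) × sumFin α ≡ r
fill {zero}  cap zero r≤ = (λ ()) , (λ ()) , refl
fill {suc n} cap r r≤
  with fill (cap ∘ suc) (r ∸ cap zero) (m≤n+o⇒m∸n≤o r (cap zero) r≤)
... | α , α≤ , Σα = (cap zero ⊓ r ∷ α) , (λ { zero → m⊓n≤m (cap zero) r ; (suc i) → α≤ i })
    , trans (cong (cap zero ⊓ r +_) Σα) (m⊓n+n∸m≡n (cap zero) r)

rank : ∀ {n} → (Fin n → Bool) → Fin n → ℕ
rank P zero    = 0
rank P (suc v) = 𝟙 (P zero) + rank (P ∘ suc) v

rank<count : ∀ {n} (P : Fin n → Bool) v → P v ≡ true → rank P v < count P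
rank<count P zero    Pv rewrite Pv = s≤s z≤n
rank<count P (suc v) Pv = subst (_≤ count P) (+-suc (𝟙 (P zero)) _) (+-monoʳ-≤ (𝟙 (P zero)) (rank<count (P ∘ suc) v Pv))

rank-injective : ∀ {n} (P : Fin n → Bool) u v → P u ≡ true → P v ≡ true → rank P u ≡ rank P v → u ≡ v
rank-injective P zero    zero    Pu Pv eq = refl
rank-injective P zero    (suc v) Pu Pv eq rewrite Pu = contradiction eq λ ()
rank-injective P (suc u) zero    Pu Pv eq rewrite Pv = contradiction eq λ ()
rank-injective P (suc u) (suc v) Pu Pv eq =
  cong suc (rank-injective (P ∘ suc) u v Pu Pv (+-cancelˡ-≡ (𝟙 (P zero)) _ _ eq))

-- The offset i absorbs the shift from c to c + 1 in the induction. For k = m the bound is i, so a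
-- random colour c satisfies c + i ≥ m with probability at most i/m; `count-<` bounds the
-- complement.
count-≥ : ∀ m k i → count {m} (λ c → k ≤ᵇ toℕ c + i) ≤ m + i ∸ k
count-≥ zero    k i = z≤n
count-≥ (suc m) k i with k ≤ᵇ i | ≤ᵇ-reflects-≤ k i
... | true  | ofʸ k≤i = ≤-trans (s≤s (count≤ {m} (λ c → k ≤ᵇ suc (toℕ c + i)))) (≤-trans (m≤m+n (suc m) (i ∸ k)) (≤-reflexive (≡.sym (+-∸-assoc (suc m) k≤i))))
... | false | _ = begin
  count {m} (λ c → k ≤ᵇ suc (toℕ c + i)) ≡⟨ sum-cong {m} (λ c → cong (λ x → 𝟙 (k ≤ᵇ x)) (≡.sym (+-suc (toℕ c) i))) ⟩
  count {m} (λ c → k ≤ᵇ toℕ c + suc i)   ≤⟨ count-≥ m k (suc i) ⟩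
  m + suc i ∸ k                      ≡⟨ cong (_∸ k) (+-suc m i) ⟩
  suc m + i ∸ k                      ∎
  where open ≤-Reasoning

count-< : ∀ m k i → count {m} (λ c → not (k ≤ᵇ toℕ c + i)) ≤ k ∸ i
count-< zero    k i = z≤n
count-< (suc m) k i = begin
  𝟙 (not (k ≤ᵇ i)) + count {m} (λ c → not (k ≤ᵇ suc (toℕ c + i)))
    ≡⟨ cong (𝟙 (not (k ≤ᵇ i)) +_) (sum-cong {m} λ c → cong (λ x → 𝟙 (not (k ≤ᵇ x))) (≡.sym (+-suc (toℕ c) i))) ⟩
  𝟙 (not (k ≤ᵇ i)) + count {m} (λ c → not (k ≤ᵇ toℕ c + suc i))
    ≤⟨ +-monoʳ-≤ (𝟙 (not (k ≤ᵇ i))) (count-< m k (suc i)) ⟩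
  𝟙 (not (k ≤ᵇ i)) + (k ∸ suc i)
    ≤⟨ step ⟩
  k ∸ i ∎
  where
  open ≤-Reasoning
  step : 𝟙 (not (k ≤ᵇ i)) + (k ∸ suc i) ≤ k ∸ i
  step with k ≤ᵇ i | ≤ᵇ-reflects-≤ k i
  ... | true  | _ = ∸-monoʳ-≤ k (n≤1+n i)
  ... | false | ofⁿ k≰i = ≤-reflexive (≡.sym (+-∸-assoc 1 (≰⇒> k≰i)))

progression-shift : ∀ p c s → p * suc c + s ≡ p * c + (p + s)
progression-shift = solve-∀

count-progression-below : ∀ m p s z →
  p * count {m} (λ c → p * toℕ c + s <ᵇ z) ≤ (z ∸ s) + p
count-progression-below zero    p s z rewrite *-zeroʳ p = z≤n
count-progression-below (suc m) p s z = begin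
  p * (𝟙 (p * 0 + s <ᵇ z) + count {m} (λ c → p * suc (toℕ c) + s <ᵇ z))
    ≡⟨ cong₂ (λ a b → p * (𝟙 (a + s <ᵇ z) + b)) (*-zeroʳ p)
         (sum-cong {m} λ c → cong (λ x → 𝟙 (x <ᵇ z)) (progression-shift p (toℕ c) s)) ⟩
  p * (𝟙 (s <ᵇ z) + rest)
    ≤⟨ step ⟩
  (z ∸ s) + p ∎
  where
  open ≤-Reasoning
  rest : ℕ
  rest = count {m} (λ c → p * toℕ c + (p + s) <ᵇ z)
  ih : p * rest ≤ (z ∸ (p + s)) + p
  ih = count-progression-below m p (p + s) z
  step : p * (𝟙 (s <ᵇ z) + rest) ≤ (z ∸ s) + p
  step with s <ᵇ z | <ᵇ-reflects-< s z
  ... | false | _ = ≤-trans ih (+-monoˡ-≤ p (∸-monoʳ-≤ z (m≤n+m s p)))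
  ... | true  | ofʸ s<z with p + s ≤? z
  ...   | yes p+s≤z = begin
    p * suc rest            ≡⟨ *-suc p rest ⟩
    p + p * rest            ≤⟨ +-monoʳ-≤ p ih ⟩
    p + ((z ∸ (p + s)) + p) ≡⟨ +-assoc p (z ∸ (p + s)) p ⟨
    p + (z ∸ (p + s)) + p   ≡⟨ cong (λ x → p + x + p) (trans (cong (z ∸_) (+-comm p s)) (≡.sym (∸-+-assoc z s p))) ⟩
    p + (z ∸ s ∸ p) + p     ≡⟨ cong (_+ p) (m+[n∸m]≡n (m+n≤o⇒m≤o∸n p p+s≤z)) ⟩
    (z ∸ s) + p             ∎
  ...   | no p+s≰z = begin
    p * suc rest            ≡⟨ cong (λ x → p * suc x) rest≡0 ⟩
    p * 1                   ≡⟨ *-identityʳ p ⟩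
    p                       ≤⟨ m≤n+m p (z ∸ s) ⟩
    (z ∸ s) + p             ∎
    where
    none : ∀ x → p + s ≤ x → 𝟙 (x <ᵇ z) ≡ 0
    none x ≤x with x <ᵇ z | <ᵇ-reflects-< x z
    ... | false | _ = refl
    ... | true  | ofʸ x<z = contradiction (≤-trans ≤x (<⇒≤ x<z)) p+s≰z
    rest≡0 : rest ≡ 0
    rest≡0 = sum-zero {m} λ c → none (p * toℕ c + (p + s)) (m≤n+m (p + s) (p * toℕ c))

-- Terms below x are discarded one by one. Once the first term s is at least x, only the upper end
-- matters, and its distance from s is at most y.
count-progression : ∀ m p s x y →
  p * count {m} (λ c → (x ≤ᵇ p * toℕ c + s) ∧ (p * toℕ c + s <ᵇ x + y)) ≤ y + p
count-progression zero    p s x y rewrite *-zeroʳ p = z≤n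
count-progression (suc m) p s x y with x ≤? s
... | yes x≤s = begin
  p * count {suc m} (λ c → (x ≤ᵇ p * toℕ c + s) ∧ (p * toℕ c + s <ᵇ x + y))
    ≤⟨ *-monoʳ-≤ p (sum-mono {suc m} λ c → drop (x ≤ᵇ p * toℕ c + s) (p * toℕ c + s <ᵇ x + y)) ⟩
  p * count {suc m} (λ c → p * toℕ c + s <ᵇ x + y)
    ≤⟨ count-progression-below (suc m) p s (x + y) ⟩
  (x + y ∸ s) + p
    ≤⟨ +-monoˡ-≤ p (m≤n+o⇒m∸n≤o (x + y) s (+-monoˡ-≤ y x≤s)) ⟩
  y + p ∎
  where
  open ≤-Reasoning
  drop : ∀ a b → 𝟙 (a ∧ b) ≤ 𝟙 b
  drop true  b = ≤-refl
  drop false b = z≤n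
... | no x≰s = begin
  p * (𝟙 ((x ≤ᵇ p * 0 + s) ∧ (p * 0 + s <ᵇ x + y)) + count {m} (λ c → (x ≤ᵇ p * suc (toℕ c) + s) ∧ (p * suc (toℕ c) + s <ᵇ x + y)))
    ≡⟨ cong₂ (λ a b → p * (𝟙 ((x ≤ᵇ a + s) ∧ (a + s <ᵇ x + y)) + b)) (*-zeroʳ p)
         (sum-cong {m} λ c → cong (λ z → 𝟙 ((x ≤ᵇ z) ∧ (z <ᵇ x + y))) (progression-shift p (toℕ c) s)) ⟩
  p * (𝟙 ((x ≤ᵇ s) ∧ (s <ᵇ x + y)) + rest)
    ≤⟨ step ⟩
  p * rest
    ≤⟨ count-progression m p (p + s) x y ⟩
  y + p ∎
  where
  open ≤-Reasoning
  rest : ℕ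
  rest = count {m} (λ c → (x ≤ᵇ p * toℕ c + (p + s)) ∧ (p * toℕ c + (p + s) <ᵇ x + y))
  step : p * (𝟙 ((x ≤ᵇ s) ∧ (s <ᵇ x + y)) + rest) ≤ p * rest
  step with x ≤ᵇ s | ≤ᵇ-reflects-≤ x s
  ... | true  | ofʸ x≤s = contradiction x≤s x≰s
  ... | false | _ = ≤-refl

-- Pigeonhole: a used candidate is deleted from the list before its successor is tried. The deletion
-- is harmless because all later candidates are larger, and it shortens the list at every failure.
fresh : ∀ (used : List ℕ) i → ∃ λ j → j ≤ length used × i + j ∉ used
fresh used i = go (length used) used i ≤-refl
  where
  go : ∀ k used i → length used ≤ k → ∃ λ j → j ≤ k × i + j ∉ used
  go k used i len≤k with i ∈? used
  ... | no i∉used = 0 , z≤n , subst (_∉ used) (≡.sym (+-identityʳ i)) i∉used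
  go zero [] i len≤k | yes ()
  go (suc k) used i len≤k | yes i∈used
    with go k (filter (λ x → ¬? (i ≟ x)) used) (suc i) (s≤s⁻¹ (≤-trans (filter-notAll (λ x → ¬? (i ≟ x)) used (lose i∈used λ i≢i → i≢i refl)) len≤k))
  ... | j , j≤k , ∉filter = suc j , s≤s j≤k , λ ∈used → ∉filter
    (∈-filter⁺ (λ x → ¬? (i ≟ x)) (subst (_∈ used) (+-suc i j) ∈used) λ i≡ → m≢1+m+n i i≡)

-- Rows will be the final vertices and columns the relay vertices, with `ε` the weight above 1 on
-- the edges of `H`. `used` lists the quotients taken by earlier rows, and the column states pass
-- from `s` before the first row to `s′` after the last.
record Toggling {k n} (q : ℕ) (H : Fin k → Fin n → Bool) (P : Fin k → Bool) (base : Fin k → ℕ)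
                (used : List ℕ) (s : Fin n → Bool) : Set where
  field
    ε           : Fin k → Fin n → ℕ
    s′          : Fin n → Bool
    slot        : Fin k → ℕ
    ε-range     : ∀ b x → ε b x ≤ 𝟙 (H b x) * 2
    column      : ∀ x → sumFin (λ b → ε b x) + 𝟙 (s x) ≡ count (λ b → H b x) + 𝟙 (s′ x)
    row         : ∀ b → P b ≡ true → base b + sumFin (ε b) ≡ q * slot b + 2
    slot-fresh  : ∀ b → P b ≡ true → slot b ∉ used
    slot-unique : ∀ b b′ → P b ≡ true → P b′ ≡ true → slot b ≡ slot b′ → b ≡ b′

module _ {n} (H s : Fin n → Bool) (η : Fin n → ℕ) (η≤ : ∀ x → η x ≤ 𝟙 (H x)) where

  toggle-state : Fin n → Bool
  toggle-state x = if H x then 0 <ᵇ η x else s x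

  toggle-row : Fin n → ℕ
  toggle-row x = 𝟙 (H x ∧ not (s x)) + η x

  toggle-row-range : ∀ x → toggle-row x ≤ 𝟙 (H x) * 2
  toggle-row-range x with H x | η≤ x
  ... | false | η≤0 = η≤0
  ... | true  | η≤1 = +-mono-≤ (𝟙≤1 (not (s x))) η≤1

  -- On `H` the entry is 1 - old state + new state. Down a column these differences telescope, which
  -- is why a column sum never leaves its default by more than one.
  toggle-balance : ∀ x → toggle-row x + 𝟙 (s x) ≡ 𝟙 (H x) + 𝟙 (toggle-state x)
  toggle-balance x with H x | s x | η x | η≤ x
  ... | false | _     | zero        | _ = refl
  ... | true  | true  | zero        | _ = refl
  ... | true  | true  | suc zero    | _ = refl
  ... | true  | true  | suc (suc _) | s≤s ()
  ... | true  | false | zero        | _ = refl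
  ... | true  | false | suc zero    | _ = refl
  ... | true  | false | suc (suc _) | s≤s ()

-- Every entry of a row b with P b has default 1, and s x records that column x is one above its default sum.
-- An entry of a column at its default can be 1 or 2, one of a raised column 0 or 1, so that the row sum takes
-- every value of an interval of length count (H b).
toggling : ∀ {k n} q (H : Fin k → Fin n → Bool) (P : Fin k → Bool) (base : Fin k → ℕ) (used : List ℕ)
  (s : Fin n → Bool) → 2 ≤ q → (∀ b → P b ≡ true → q * (length used + suc (count P)) ≤ count (H b)) →
  Toggling q H P base used s
toggling {zero} q H P base used s 2≤q room = record
  { ε = λ () ; s′ = s ; slot = λ () ; ε-range = λ () ; column = λ _ → refl
  ; row = λ () ; slot-fresh = λ () ; slot-unique = λ () }
toggling {suc k} {n} q H P base used s 2≤q room with P zero in P0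
... | false = record
  -- A row outside `P` receives the default entries and thus leaves all column states alone.
  { ε = (𝟙 ∘ H zero) ∷ ε rec
  ; s′ = s′ rec
  ; slot = 0 ∷ slot rec
  ; ε-range = λ { zero x → m≤m*n (𝟙 (H zero x)) 2 ; (suc b) x → ε-range rec b x }
  ; column = λ x → trans (+-assoc (𝟙 (H zero x)) _ _)
      (trans (cong (𝟙 (H zero x) +_) (column rec x)) (≡.sym (+-assoc (𝟙 (H zero x)) _ _)))
  ; row = λ { zero P0′ → contradiction (trans (≡.sym P0) P0′) λ () ; (suc b) → row rec b }
  ; slot-fresh = λ { zero P0′ → contradiction (trans (≡.sym P0) P0′) λ () ; (suc b) → slot-fresh rec b }
  ; slot-unique = λ
      { zero    b′       P0′ _   → contradiction (trans (≡.sym P0) P0′) λ ()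
      ; (suc b) zero     _   P0′ → contradiction (trans (≡.sym P0) P0′) λ ()
      ; (suc b) (suc b′) Pb  Pb′ eq → cong suc (slot-unique rec b b′ Pb Pb′ eq) }
  }
  where
  open Toggling
  rec : Toggling q (H ∘ suc) (P ∘ suc) (base ∘ suc) used s
  rec = toggling q (H ∘ suc) (P ∘ suc) (base ∘ suc) used s 2≤q (room ∘ suc)
... | true = record
  { ε = toggle-row (H zero) s η η≤ ∷ ε rec
  ; s′ = s′ rec
  ; slot = i ∷ slot rec
  ; ε-range = λ { zero → toggle-row-range (H zero) s η η≤ ; (suc b) → ε-range rec b }
  ; column = column′
  ; row = λ { zero _ → row-zero ; (suc b) → row rec b }
  ; slot-fresh = λ { zero _ → i∉used ; (suc b) Pb ∈used → slot-fresh rec b Pb (there ∈used) }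
  ; slot-unique = λ
      { zero    zero     _   _   _  → refl
      ; zero    (suc b′) _   Pb′ eq → contradiction (here (≡.sym eq)) (slot-fresh rec b′ Pb′)
      ; (suc b) zero     Pb  _   eq → contradiction (here eq) (slot-fresh rec b Pb)
      ; (suc b) (suc b′) Pb  Pb′ eq → cong suc (slot-unique rec b b′ Pb Pb′ eq) }
  }
  where
  open Toggling
  open ≤-Reasoning
  instance
    q≢0 : NonZero q
    q≢0 = >-nonZero (≤-trans (s≤s z≤n) 2≤q)
  low base′ i j : ℕ
  low   = count (λ x → H zero x ∧ not (s x))
  base′ = base zero + low
  -- `base′` is the least attainable row sum. Starting the search one above its quotient makes q i +
  -- 2 at least `base′`, and at most `length used` candidates are skipped, so the target stays
  -- within q (`length used` + 2) of it.
  j     = proj₁ (fresh used (suc (base′ / q)))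
  i     = suc (base′ / q) + j
  j≤ : j ≤ length used
  j≤ = proj₁ (proj₂ (fresh used (suc (base′ / q))))
  i∉used : i ∉ used
  i∉used = proj₂ (proj₂ (fresh used (suc (base′ / q))))
  base′≤ : base′ ≤ q * i + 2
  base′≤ = begin
    base′                       ≡⟨ m≡m%n+[m/n]*n base′ q ⟩
    base′ % q + base′ / q * q   ≤⟨ +-monoˡ-≤ (base′ / q * q) (m%n≤n base′ q) ⟩
    suc (base′ / q) * q         ≤⟨ *-monoˡ-≤ q (m≤m+n (suc (base′ / q)) j) ⟩
    i * q                       ≡⟨ *-comm i q ⟩
    q * i                       ≤⟨ m≤m+n (q * i) 2 ⟩
    q * i + 2                   ∎
  ≤base′ : q * i + 2 ≤ base′ + count (H zero)
  ≤base′ = begin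
    q * i + 2                                    ≤⟨ +-monoʳ-≤ (q * i) 2≤q ⟩
    q * i + q                                    ≡⟨ lemma q (base′ / q) j ⟩
    base′ / q * q + q * (j + 2)                  ≤⟨ +-mono-≤ (m/n*n≤m base′ q) (*-monoʳ-≤ q (+-mono-≤ j≤ (s≤s (s≤s z≤n)))) ⟩
    base′ + q * (length used + suc (suc (count (P ∘ suc)))) ≤⟨ +-monoʳ-≤ base′ (room zero P0) ⟩
    base′ + count (H zero)                       ∎
    where
    lemma : ∀ q d j → q * (suc d + j) + q ≡ d * q + q * (j + 2)
    lemma = solve-∀
  filled = fill (𝟙 ∘ H zero) (q * i + 2 ∸ base′) (m≤n+o⇒m∸n≤o (q * i + 2) base′ ≤base′)
  η : Fin n → ℕ
  η = proj₁ filled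
  η≤ : ∀ x → η x ≤ 𝟙 (H zero x)
  η≤ = proj₁ (proj₂ filled)
  row-zero : base zero + sumFin (toggle-row (H zero) s η η≤) ≡ q * i + 2
  row-zero = ≡.trans (cong (base zero +_) (sum-+ (λ x → 𝟙 (H zero x ∧ not (s x))) η))
    (≡.trans (≡.sym (+-assoc (base zero) low (sumFin η)))
    (≡.trans (cong (base′ +_) (proj₂ (proj₂ filled))) (m+[n∸m]≡n base′≤)))
  s₁ : Fin n → Bool
  s₁ = toggle-state (H zero) s η η≤
  rec : Toggling q (H ∘ suc) (P ∘ suc) (base ∘ suc) (i ◂ used) s₁
  rec = toggling q (H ∘ suc) (P ∘ suc) (base ∘ suc) (i ◂ used) s₁ 2≤q
    -- The list has grown by one and the number of rows of `P` still to come has dropped by one: the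
    -- room required is invariant.
    λ b Pb → subst (λ x → q * x ≤ count (H (suc b))) (+-suc (length used) (suc (count (P ∘ suc)))) (room (suc b) Pb)
  column′ : ∀ x → toggle-row (H zero) s η η≤ x + sumFin (λ b → ε rec b x) + 𝟙 (s x)
                ≡ 𝟙 (H zero x) + count (λ b → H (suc b) x) + 𝟙 (s′ rec x)
  column′ x = ≡.trans (lemma (toggle-row (H zero) s η η≤ x) (sumFin (λ b → ε rec b x)) (𝟙 (s x)))
    (≡.trans (cong (_+ sumFin (λ b → ε rec b x)) (toggle-balance (H zero) s η η≤ x))
    (≡.trans (lemma′ (𝟙 (H zero x)) (𝟙 (s₁ x)) (sumFin (λ b → ε rec b x)))
    (≡.trans (cong (𝟙 (H zero x) +_) (column rec x)) (≡.sym (+-assoc (𝟙 (H zero x)) _ _)))))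
    where
    lemma : ∀ a b c → a + b + c ≡ a + c + b
    lemma = solve-∀
    lemma′ : ∀ a b c → a + b + c ≡ a + (c + b)
    lemma′ = solve-∀

quotient-remainder-unique : ∀ q .{{_ : NonZero q}} i r i′ r′ → r < q → r′ < q →
  q * i + r ≡ q * i′ + r′ → i ≡ i′ × r ≡ r′
quotient-remainder-unique q i r i′ r′ r<q r′<q eq =
  *-cancelˡ-≡ i i′ q (+-cancelʳ-≡ r′ _ _ (subst (λ x → q * i + x ≡ q * i′ + r′) r≡r′ eq)) , r≡r′
  where
  remainder : ∀ i r → r < q → (q * i + r) % q ≡ r
  remainder i r r<q = trans (cong (_% q) (trans (+-comm (q * i) r) (cong (r +_) (*-comm q i))))
    (trans ([m+kn]%n≡m%n r i q) (m<n⇒m%n≡m r<q))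
  r≡r′ : r ≡ r′
  r≡r′ = trans (≡.sym (remainder i r r<q)) (trans (cong (_% q) eq) (remainder i′ r′ r′<q))

-- Exponentials against powers of two.

-- 2^N N! times the N-th partial sum of the series of e^(r/2).
halfExpScaled : ℕ → ℕ → ℕ
halfExpScaled r zero    = 1
halfExpScaled r (suc N) = 2 * suc N * halfExpScaled r N + r ^ suc N

halfExpScaled-even : ∀ p N → halfExpScaled (2 * p) N ≡ 2 ^ N * expSeriesScaled p N
halfExpScaled-even p zero    = refl
halfExpScaled-even p (suc N) rewrite halfExpScaled-even p N | ^-distribʳ-* 2 p (suc N) =
  lemma (suc N) (2 ^ N) (expSeriesScaled p N) (p ^ suc N)
  where
  lemma : ∀ a b c d → 2 * a * (b * c) + 2 * b * d ≡ 2 * b * (a * c + d)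
  lemma = solve-∀

halfExpScaled-zero : ∀ N → halfExpScaled 0 N ≡ 2 ^ N * N !
halfExpScaled-zero zero    = refl
halfExpScaled-zero (suc N) rewrite halfExpScaled-zero N = lemma (suc N) (2 ^ N) (N !)
  where
  lemma : ∀ a b c → 2 * a * (b * c) + 0 ≡ 2 * b * (a * c)
  lemma = solve-∀

suc-^-≤ : ∀ r N → suc r ^ suc N ≤ r ^ suc N + suc N * suc r ^ N
suc-^-≤ r zero    = ≤-reflexive (lemma r)
  where
  lemma : ∀ r → suc r * 1 ≡ r * 1 + 1
  lemma = solve-∀
suc-^-≤ r (suc N) = begin
  suc r * suc r ^ suc N                               ≤⟨ *-monoʳ-≤ (suc r) (suc-^-≤ r N) ⟩
  suc r * (r ^ suc N + suc N * suc r ^ N)             ≡⟨ lemma r (r ^ suc N) (suc N) (suc r ^ N) ⟩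
  r * r ^ suc N + (r ^ suc N + suc N * suc r ^ suc N) ≤⟨ +-monoʳ-≤ (r * r ^ suc N) (+-monoˡ-≤ (suc N * suc r ^ suc N) (^-monoˡ-≤ (suc N) (n≤1+n r))) ⟩
  r * r ^ suc N + suc (suc N) * suc r ^ suc N         ∎
  where
  open ≤-Reasoning
  lemma : ∀ r x k y → suc r * (x + k * y) ≡ r * x + (x + k * (suc r * y))
  lemma = solve-∀

-- The mean value inequality f(r+1) − f(r) ≤ f′(r+1) for the partial sums f.
halfExpScaled-increment : ∀ r N → halfExpScaled (suc r) (suc N) ≤ halfExpScaled r (suc N) + suc N * halfExpScaled (suc r) N
halfExpScaled-increment r zero = ≤-reflexive (lemma r)
  where
  lemma : ∀ r → 2 + suc r * 1 ≡ 2 + r * 1 + 1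
  lemma = solve-∀
halfExpScaled-increment r (suc N) = begin
  2 * k * H′ + suc r ^ k
    ≤⟨ +-mono-≤ (*-monoʳ-≤ (2 * k) (halfExpScaled-increment r N)) (suc-^-≤ r (suc N)) ⟩
  2 * k * (H + suc N * H″) + (r ^ k + k * suc r ^ suc N)
    ≡⟨ lemma k H (suc N) H″ (r ^ k) (suc r ^ suc N) ⟩
  2 * k * H + r ^ k + k * (2 * suc N * H″ + suc r ^ suc N) ∎
  where
  open ≤-Reasoning
  k H H′ H″ : ℕ
  k  = suc (suc N)
  H  = halfExpScaled r (suc N)
  H′ = halfExpScaled (suc r) (suc N)
  H″ = halfExpScaled (suc r) N
  lemma : ∀ k H n H″ x y → 2 * k * (H + n * H″) + (x + k * y) ≡ 2 * k * H + x + k * (2 * n * H″ + y)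
  lemma = solve-∀

-- The derivative of e^(r/2) is half the function, so the mean value inequality bounds the increment
-- by half of the new value. The halved exponent is used because the same argument for e^r would
-- give no bound.
halfExpScaled-doubling : ∀ r N → halfExpScaled (suc r) N ≤ 2 * halfExpScaled r N
halfExpScaled-doubling r zero    = s≤s z≤n
halfExpScaled-doubling r (suc N) = +-cancelʳ-≤ H′ H′ (2 * H) (begin
  H′ + H′                                        ≡⟨ cong (H′ +_) (+-identityʳ H′) ⟨
  2 * H′                                         ≤⟨ *-monoʳ-≤ 2 (halfExpScaled-increment r N) ⟩
  2 * (H + suc N * halfExpScaled (suc r) N)      ≡⟨ lemma H (suc N) (halfExpScaled (suc r) N) ⟩
  2 * H + 2 * suc N * halfExpScaled (suc r) N    ≤⟨ +-monoʳ-≤ (2 * H) (m≤m+n _ (suc r ^ suc N)) ⟩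
  2 * H + H′                                     ∎)
  where
  open ≤-Reasoning
  H H′ : ℕ
  H  = halfExpScaled r (suc N)
  H′ = halfExpScaled (suc r) (suc N)
  lemma : ∀ H n x → 2 * (H + n * x) ≡ 2 * H + 2 * n * x
  lemma = solve-∀

halfExpScaled-≤ : ∀ r N → halfExpScaled r N ≤ 2 ^ r * (2 ^ N * N !)
halfExpScaled-≤ zero    N = ≤-reflexive (trans (halfExpScaled-zero N) (≡.sym (+-identityʳ _)))
halfExpScaled-≤ (suc r) N = ≤-trans (halfExpScaled-doubling r N)
  (≤-trans (*-monoʳ-≤ 2 (halfExpScaled-≤ r N)) (≤-reflexive (≡.sym (*-assoc 2 (2 ^ r) _))))

-- Amounts to e ≤ 4, obtained by doubling 2p times along e^(r/2). It turns the natural logarithm of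
-- the hypothesis into a binary one at the cost of a factor 2.
LeExp⇒≤2^ : ∀ {m p} → LeExp m p → m ≤ 2 ^ (2 * p)
LeExp⇒≤2^ {m} {p} (N , le) = *-cancelˡ-≤ (2 ^ N * N !) {{m*n≢0 (2 ^ N) (N !) {{m^n≢0 2 N}} {{N !≢0}}}} (begin
  2 ^ N * N ! * m               ≡⟨ lemma (2 ^ N) (N !) m ⟩
  2 ^ N * (m * N !)             ≤⟨ *-monoʳ-≤ (2 ^ N) le ⟩
  2 ^ N * expSeriesScaled p N   ≡⟨ halfExpScaled-even p N ⟨
  halfExpScaled (2 * p) N       ≤⟨ halfExpScaled-≤ (2 * p) N ⟩
  2 ^ (2 * p) * (2 ^ N * N !)   ≡⟨ *-comm (2 ^ (2 * p)) _ ⟩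
  2 ^ N * N ! * 2 ^ (2 * p)     ∎)
  where
  open ≤-Reasoning
  lemma : ∀ a b c → a * b * c ≡ a * (c * b)
  lemma = solve-∀

-- Random colours: discrepancy and spreading.

chernoff-indexed : ∀ {I : Set} {N n m M l T} .{{_ : NonZero m}} .{{_ : NonZero M}} →
  Fin N ↔ I → N ≤ 2 ^ l → n + l * (M * M) ≤ M * T →
  (f : I → Fin n → Fin m → Bool) →
  ∃ λ (c : Fin n → Fin m) → ∀ i →
    m * count (λ u → f i u (c u)) ≤ sumFin (λ u → count (f i u)) + m * T
chernoff-indexed {n = n} {m} {M} {l} {T} index N≤ T-large f
  with chernoff {M = M} {l = l} {T = T} N≤ T-large (f ∘ Inverse.to index)
... | c , bound = c , λ i →
  subst (λ i → m * count (λ u → f i u (c u)) ≤ sumFin (λ u → count (f i u)) + m * T)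
    (Inverse.strictlyInverseˡ index i) (bound (Inverse.from index i))

count-split : ∀ {n} (P R : Fin n → Bool) →
  count (λ u → P u ∧ R u) + count (λ u → P u ∧ not (R u)) ≡ count P
count-split P R = trans (≡.sym (sum-+ (λ u → 𝟙 (P u ∧ R u)) (λ u → 𝟙 (P u ∧ not (R u)))))
  (sum-cong λ u → split (P u) (R u))
  where
  split : ∀ a b → 𝟙 (a ∧ b) + 𝟙 (a ∧ not b) ≡ 𝟙 a
  split false b     = refl
  split true  true  = refl
  split true  false = refl

module _ {n m} (T : ℕ) (P : Fin n → Bool) (R : Fin m → Bool) (c : Fin n → Fin m) where

  discrepancy-upper : ∀ x → count R ≤ x →
    m * count (λ u → P u ∧ R (c u)) ≤ sumFin (λ u → count (λ c → P u ∧ R c)) + m * T →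
    m * count (λ u → P u ∧ R (c u)) ≤ count P * x + m * T
  discrepancy-upper x R≤ bound = ≤-trans bound
    (+-monoˡ-≤ (m * T) (≤-trans (≤-reflexive (count-product P R)) (*-monoʳ-≤ (count P) R≤)))

  -- A lower tail for the colours in R is an upper tail for those outside, since the two counts add
  -- up to `count P`. Hence the one-sided Chernoff bound suffices.
  discrepancy-lower : ∀ x → x ≤ m → count (not ∘ R) ≤ m ∸ x →
    m * count (λ u → P u ∧ not (R (c u))) ≤ sumFin (λ u → count (λ c → P u ∧ not (R c))) + m * T →
    count P * x ≤ m * count (λ u → P u ∧ R (c u)) + m * T
  discrepancy-lower x x≤m R≤ bound = +-cancelʳ-≤ (count P * (m ∸ x)) _ _ (begin
    count P * x + count P * (m ∸ x)  ≡⟨ *-distribˡ-+ (count P) x (m ∸ x) ⟨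
    count P * (x + (m ∸ x))          ≡⟨ cong (count P *_) (m+[n∸m]≡n x≤m) ⟩
    count P * m                      ≡⟨ *-comm (count P) m ⟩
    m * count P                      ≡⟨ cong (m *_) (count-split P (R ∘ c)) ⟨
    m * (inside + outside)           ≡⟨ *-distribˡ-+ m inside outside ⟩
    m * inside + m * outside         ≤⟨ +-monoʳ-≤ (m * inside) bound ⟩
    m * inside + (sumFin (λ u → count (λ c → P u ∧ not (R c))) + m * T)
      ≡⟨ cong (λ x → m * inside + (x + m * T)) (count-product P (not ∘ R)) ⟩
    m * inside + (count P * count (not ∘ R) + m * T)
      ≤⟨ +-monoʳ-≤ (m * inside) (+-monoˡ-≤ (m * T) (*-monoʳ-≤ (count P) R≤)) ⟩
    m * inside + (count P * (m ∸ x) + m * T)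
      ≡⟨ lemma (m * inside) (count P * (m ∸ x)) (m * T) ⟩
    m * inside + m * T + count P * (m ∸ x) ∎)
    where
    open ≤-Reasoning
    inside outside : ℕ
    inside  = count (λ u → P u ∧ R (c u))
    outside = count (λ u → P u ∧ not (R (c u)))
    lemma : ∀ a b c → a + (b + c) ≡ a + c + b
    lemma = solve-∀

≡ᵇ-true : ∀ {m n} → (m ≡ᵇ n) ≡ true → m ≡ n
≡ᵇ-true {m} {n} eq = ≡ᵇ⇒≡ m n (Equivalence.from T-≡ eq)

≡ᵇ-refl : ∀ n → (n ≡ᵇ n) ≡ true
≡ᵇ-refl zero    = refl
≡ᵇ-refl (suc n) = ≡ᵇ-refl n

≤ᵇ-true : ∀ {m n} → m ≤ n → (m ≤ᵇ n) ≡ true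
≤ᵇ-true {m} {n} m≤n with m ≤ᵇ n | ≤ᵇ-reflects-≤ m n
... | true  | _ = refl
... | false | ofⁿ m≰n = contradiction m≤n m≰n

-- For a random colour c(u) the value s(u) + D #{v ∈ N(u) : c(u) + c(v) ≥ n} is spread almost uniformly over an
-- interval of length D d(u) ≥ p, so that about L/p of the vertices are expected in a block of length L.
module Spreading {n} (D L S p l M T : ℕ) .{{_ : NonZero n}} .{{_ : NonZero M}} .{{_ : NonZero L}}
  (B : Fin n → Fin n → Bool) (Q : Fin n → Bool) (s : Fin n → ℕ)
  (p≤ : ∀ v → p ≤ D * count (B v)) (s< : ∀ v → s v + D * n < S)
  (tests≤ : n * n + (n * n + S) ≤ 2 ^ l) (T-large : n + l * (M * M) ≤ M * T) where

  hits : (Fin n → Fin n) → Fin n → ℕ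
  hits c v = count (λ u → B v u ∧ (n ≤ᵇ toℕ (c u) + toℕ (c v)))

  level : (Fin n → Fin n) → Fin n → ℕ
  level c v = s v + D * hits c v

  private
    -- The hits of v depend on the colour of v, which is chosen together with all others. The first
    -- two families therefore test every possible colour i of v, and i = c(v) is inserted
    -- afterwards. The last family tests the blocks.
    Test : Set
    Test = (Fin n × Fin n) ⊎ ((Fin n × Fin n) ⊎ Fin S)

    tests : Fin (n * n + (n * n + S)) ↔ Test
    tests = ↔-trans +↔⊎ (*↔× ⊎-↔ ↔-trans +↔⊎ (*↔× ⊎-↔ ↔-refl))

    y : ℕ
    y = n * L + 2 * (n * (D * T))

    -- n times the expected level of u when its colour is c, raised by n D T. It depends on the
    -- colour of u alone, so that block counts become testable, and the true n · `level` lies below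
    -- it by at most 2 n D T. Hence the widened window of length `y`.
    pos : Fin n → Fin n → ℕ
    pos u c = D * count (B u) * toℕ c + (n * s u + n * (D * T))

    inBlock : ℕ → Fin n → Fin n → Bool
    inBlock J u c = (n * (J * L) ≤ᵇ pos u c) ∧ (pos u c <ᵇ n * (J * L) + y)

    test : Test → Fin n → Fin n → Bool
    test (inj₁ (v , i))        u c = B v u ∧ (n ≤ᵇ toℕ c + toℕ i)
    test (inj₂ (inj₁ (v , i))) u c = B v u ∧ not (n ≤ᵇ toℕ c + toℕ i)
    test (inj₂ (inj₂ J))       u c = Q u ∧ inBlock (toℕ J) u c

    -- As the colour of u varies, `pos` runs through a progression of step p′ = D `count (B u)` ≥ p.
    -- If k ≥ 1 terms meet the window then p′ (k - 1) ≤ y, so p (k - 1) ≤ y as well; `rescale` does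
    -- this.
    block-mean : ∀ J → p * sumFin (λ u → count (λ c → Q u ∧ inBlock J u c)) ≤ n * (y + p)
    block-mean J = begin
      p * sumFin (λ u → count (λ c → Q u ∧ inBlock J u c))    ≡⟨ sum-*ˡ p (λ u → count (λ c → Q u ∧ inBlock J u c)) ⟨
      sumFin (λ u → p * count (λ c → Q u ∧ inBlock J u c))    ≤⟨ sum-≤-const term ⟩
      n * (y + p) ∎
      where
      open ≤-Reasoning
      rescale : ∀ p′ k → p ≤ p′ → p′ * k ≤ y + p′ → p * k ≤ y + p
      rescale p′ zero    p≤p′ le = ≤-trans (≤-reflexive (*-zeroʳ p)) z≤n
      rescale p′ (suc k) p≤p′ le = begin
        p * suc k   ≡⟨ *-suc p k ⟩
        p + p * k   ≤⟨ +-monoʳ-≤ p (*-monoˡ-≤ k p≤p′) ⟩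
        p + p′ * k  ≤⟨ +-monoʳ-≤ p (+-cancelˡ-≤ p′ _ _ (≤-trans (≤-reflexive (≡.sym (*-suc p′ k))) (≤-trans le (≤-reflexive (+-comm y p′))))) ⟩
        p + y       ≡⟨ +-comm p y ⟩
        y + p       ∎
      term : ∀ u → p * count (λ c → Q u ∧ inBlock J u c) ≤ y + p
      term u with Q u
      ... | true  = rescale (D * count (B u)) _ (p≤ u)
        (count-progression n (D * count (B u)) (n * s u + n * (D * T)) (n * (J * L)) y)
      ... | false = ≤-trans (≤-reflexive (trans (cong (p *_) (sum-zero {n} λ _ → refl)) (*-zeroʳ p))) z≤n

  spreading : ∃ λ (c : Fin n → Fin n) → ∀ J → J < S →
    p * count (λ u → Q u ∧ (level c u / L ≡ᵇ J)) ≤ n * (L + 2 * (D * T)) + p + p * T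
  spreading with chernoff-indexed {M = M} {l = l} {T = T} tests tests≤ T-large test
  ... | c , bound = c , block-bound
    where
    open ≤-Reasoning
    d : Fin n → ℕ
    d u = count (B u)
    i : Fin n → ℕ
    i u = toℕ (c u)
    hits-upper : ∀ v → n * hits c v ≤ d v * i v + n * T
    hits-upper v = discrepancy-upper T (B v) (λ c′ → n ≤ᵇ toℕ c′ + i v) c (i v)
      (≤-trans (count-≥ n n (i v)) (≤-reflexive (m+n∸m≡n n (i v)))) (bound (inj₁ (v , c v)))
    hits-lower : ∀ v → d v * i v ≤ n * hits c v + n * T
    hits-lower v = discrepancy-lower T (B v) (λ c′ → n ≤ᵇ toℕ c′ + i v) c (i v)
      (<⇒≤ (toℕ<n (c v))) (count-< n n (i v)) (bound (inj₂ (inj₁ (v , c v))))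
    pos-lower : ∀ u → n * level c u ≤ pos u (c u)
    pos-lower u = begin
      n * (s u + D * hits c u)                       ≡⟨ lemma₁ n (s u) D (hits c u) ⟩
      n * s u + D * (n * hits c u)                   ≤⟨ +-monoʳ-≤ (n * s u) (*-monoʳ-≤ D (hits-upper u)) ⟩
      n * s u + D * (d u * i u + n * T)              ≡⟨ lemma₂ n (s u) D (d u) (i u) T ⟩
      pos u (c u)                                    ∎
      where
      lemma₁ : ∀ n s D h → n * (s + D * h) ≡ n * s + D * (n * h)
      lemma₁ = solve-∀
      lemma₂ : ∀ n s D d i T → n * s + D * (d * i + n * T) ≡ D * d * i + (n * s + n * (D * T))
      lemma₂ = solve-∀
    pos-upper : ∀ u → pos u (c u) ≤ n * level c u + 2 * (n * (D * T))
    pos-upper u = begin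
      D * d u * i u + (n * s u + n * (D * T))              ≡⟨ cong (_+ (n * s u + n * (D * T))) (*-assoc D (d u) (i u)) ⟩
      D * (d u * i u) + (n * s u + n * (D * T))            ≤⟨ +-monoˡ-≤ _ (*-monoʳ-≤ D (hits-lower u)) ⟩
      D * (n * hits c u + n * T) + (n * s u + n * (D * T)) ≡⟨ lemma D n (hits c u) T (s u) ⟩
      n * level c u + 2 * (n * (D * T))                    ∎
      where
      lemma : ∀ D n h T s → D * (n * h + n * T) + (n * s + n * (D * T)) ≡ n * (s + D * h) + 2 * (n * (D * T))
      lemma = solve-∀
    in-block : ∀ J u → level c u / L ≡ J → inBlock J u (c u) ≡ true
    in-block J u refl = cong₂ _∧_ (≤ᵇ-true below) (≤ᵇ-true above)
      where
      below : n * (level c u / L * L) ≤ pos u (c u)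
      below = ≤-trans (*-monoʳ-≤ n (m/n*n≤m (level c u) L)) (pos-lower u)
      level< : level c u < L + level c u / L * L
      level< = begin-strict
        level c u                                 ≡⟨ m≡m%n+[m/n]*n (level c u) L ⟩
        level c u % L + level c u / L * L         <⟨ +-monoˡ-< (level c u / L * L) (m%n<n (level c u) L) ⟩
        L + level c u / L * L                     ∎
      above : pos u (c u) < n * (level c u / L * L) + y
      above = begin-strict
        pos u (c u)                                             ≤⟨ pos-upper u ⟩
        n * level c u + 2 * (n * (D * T))                       <⟨ +-monoˡ-< (2 * (n * (D * T))) (*-monoʳ-< n level<) ⟩
        n * (L + level c u / L * L) + 2 * (n * (D * T))         ≡⟨ lemma n L (level c u / L * L) (2 * (n * (D * T))) ⟩
        n * (level c u / L * L) + y                             ∎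
        where
        lemma : ∀ n L x z → n * (L + x) + z ≡ n * x + (n * L + z)
        lemma = solve-∀
    pointwise : ∀ J u → 𝟙 (Q u ∧ (level c u / L ≡ᵇ J)) ≤ 𝟙 (Q u ∧ inBlock J u (c u))
    pointwise J u with Q u
    ... | false = z≤n
    ... | true with level c u / L ≡ᵇ J in eq
    ...   | false = z≤n
    ...   | true rewrite in-block J u (≡ᵇ-true eq) = ≤-refl
    block-bound : ∀ J → J < S → p * count (λ u → Q u ∧ (level c u / L ≡ᵇ J)) ≤ n * (L + 2 * (D * T)) + p + p * T
    block-bound J J<S = *-cancelˡ-≤ n (begin
      n * (p * count (λ u → Q u ∧ (level c u / L ≡ᵇ J)))
        ≤⟨ *-monoʳ-≤ n (*-monoʳ-≤ p (sum-mono (pointwise J))) ⟩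
      n * (p * count (λ u → Q u ∧ inBlock J u (c u)))
        ≡⟨ swap n p _ ⟩
      p * (n * count (λ u → Q u ∧ inBlock J u (c u)))
        ≤⟨ *-monoʳ-≤ p (subst (λ J → n * count (λ u → Q u ∧ inBlock J u (c u)) ≤ sumFin (λ u → count (λ c → Q u ∧ inBlock J u c)) + n * T)
             (toℕ-fromℕ< J<S) (bound (inj₂ (inj₂ (fromℕ< J<S))))) ⟩
      p * (sumFin (λ u → count (λ c → Q u ∧ inBlock J u c)) + n * T)
        ≡⟨ *-distribˡ-+ p _ (n * T) ⟩
      p * sumFin (λ u → count (λ c → Q u ∧ inBlock J u c)) + p * (n * T)
        ≤⟨ +-monoˡ-≤ (p * (n * T)) (block-mean J) ⟩
      n * (y + p) + p * (n * T)
        ≡⟨ lemma n L D T p ⟩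
      n * (n * (L + 2 * (D * T)) + p + p * T) ∎)
      where
      swap : ∀ a b c → a * (b * c) ≡ b * (a * c)
      swap = solve-∀
      lemma : ∀ n L D T p → n * (n * L + 2 * (n * (D * T)) + p) + p * (n * T) ≡ n * (n * (L + 2 * (D * T)) + p + p * T)
      lemma = solve-∀

-- Kinds of vertices and the numerical conditions.

data Kind : Set where
  main relay final : Kind

isMain isRelay isFinal : Kind → Bool
isMain main  = true
isMain relay = false
isMain final = false
isRelay main  = false
isRelay relay = true
isRelay final = false
isFinal main  = false
isFinal relay = false
isFinal final = true

module Links {n} (G : Graph n) (kind : Fin n → Kind) where

  link : (Kind → Bool) → (Kind → Bool) → Fin n → Fin n → Bool
  link P Q u v = P (kind u) ∧ (adj G u v ∧ Q (kind v))

  degreeTo : (Kind → Bool) → Fin n → ℕ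
  degreeTo Q v = count (λ u → adj G v u ∧ Q (kind u))

  number : (Kind → Bool) → ℕ
  number Q = count (Q ∘ kind)

-- q = 3 + q′ is the period of the reservation of values: residues 0 and 1 for relay vertices, 2 for final
-- vertices, the others for main vertices.
record Parameters {n} (G : Graph n) (D : ℕ) : Set where
  field
    kind : Fin n → Kind
  open Links G kind
  field
    q′ T l M p : ℕ
    {{q′≢0}}   : NonZero q′
    {{M≢0}}    : NonZero M
    2≤D        : 2 ≤ D
    n≤p        : n ≤ p
    toMain     : ∀ v → p ≤ D * degreeTo isMain v
    toRelay    : ∀ v → (3 + q′) * suc (number isFinal) ≤ degreeTo isRelay v
    toFinal    : ∀ v → 2 * ((3 + q′) * suc T) ≤ degreeTo isFinal v
    degree≥    : ∀ v → number isFinal + (3 + q′) + (3 + q′) * number isRelay ≤ degree G v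
    density    : n * ((3 + q′) * suc T + 2 * (D * T)) + p + p * T ≤ p * (suc T * q′)
    tests≤     : n * n + (n * n + suc (n + 2 * (n * D))) ≤ 2 ^ l
    T-large    : n + l * (M * M) ≤ M * T

𝟙≢2+ : ∀ b {x} → 𝟙 b ≢ 2 + x
𝟙≢2+ true  ()
𝟙≢2+ false ()

supported : ∀ {x b k} → x ≤ 𝟙 b * k → b ≡ false → x ≡ 0
supported x≤ refl = n≤0⇒n≡0 x≤

slots-divide : ∀ k d .{{_ : NonZero d}} ρ → ρ < k * d → ρ / d < k
slots-divide k d ρ ρ< = m<n*o⇒m/o<n {ρ} {k} {d} ρ<

-- The weighting and the distinctness of its degrees.

module Construction {n} (G : Graph (suc n)) (D : ℕ) (params : Parameters G D) where
  open Parameters params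
  open Links G kind

  V : Set
  V = Fin (suc n)

  q L k₀ : ℕ
  q  = 3 + q′
  L  = q * suc T
  -- q `k₀` is at least n + `number isFinal` for the order n of the graph, hence no smaller than the
  -- default sum of any relay vertex.
  k₀ = suc ((suc n + number isFinal) / q)

  restrict : Bool → ℕ → ℕ
  restrict b r = if b then r else 0

  -- Each vertex of kind `P` distributes its demand over its edges to kind `Q`, at most k on each;
  -- all other rows vanish. Used with k = D from relay to main vertices and with k = 1 from main to
  -- final vertices.
  supply : ∀ (P Q : Kind → Bool) k (r : V → ℕ) → (∀ v → P (kind v) ≡ true → r v ≤ degreeTo Q v * k) →
    ∃ λ (α : V → V → ℕ) → (∀ u v → α u v ≤ 𝟙 (link P Q u v) * k) × (∀ u → P (kind u) ≡ true → sumFin (α u) ≡ r u)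
  supply P Q k r r≤ = (λ u → proj₁ (row u)) , (λ u → proj₁ (proj₂ (row u))) , row-sum
    where
    capacity : ∀ u → restrict (P (kind u)) (r u) ≤ sumFin (λ v → 𝟙 (link P Q u v) * k)
    capacity u with P (kind u) in eq
    ... | true  = ≤-trans (r≤ u eq) (≤-reflexive (≡.sym (sum-*ʳ k (λ v → 𝟙 (adj G u v ∧ Q (kind v))))))
    ... | false = z≤n
    row : ∀ u → ∃ λ (α : V → ℕ) → (∀ v → α v ≤ 𝟙 (link P Q u v) * k) × sumFin α ≡ restrict (P (kind u)) (r u)
    row u = fill (λ v → 𝟙 (link P Q u v) * k) (restrict (P (kind u)) (r u)) (capacity u)
    row-sum : ∀ u → P (kind u) ≡ true → sumFin (proj₁ (row u)) ≡ r u
    row-sum u eq = trans (proj₂ (proj₂ (row u))) (cong (λ b → restrict b (r u)) eq)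

  link-left : ∀ P Q u v → P (kind u) ≡ false → link P Q u v ≡ false
  link-left P Q u v eq = cong (_∧ (adj G u v ∧ Q (kind v))) eq

  link-right : ∀ P Q u v → Q (kind v) ≡ false → link P Q u v ≡ false
  link-right P Q u v eq rewrite eq | ∧-zeroʳ (adj G u v) = ∧-zeroʳ (P (kind u))

  link-edge : ∀ P Q u v → adj G u v ≡ false → link P Q u v ≡ false
  link-edge P Q u v eq rewrite eq = ∧-zeroʳ (P (kind u))

  relayRank : V → ℕ
  relayRank = rank (isRelay ∘ kind)

  relayTarget : V → ℕ
  relayTarget x = q * (k₀ + relayRank x)

  -- The default sum on the left has `degreeTo isFinal` added because an edge to a final vertex
  -- carries one extra unit by default in `toggling`.
  relayTarget-lower : ∀ x → degree G x + degreeTo isFinal x ≤ relayTarget x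
  relayTarget-lower x = begin
    degree G x + degreeTo isFinal x   ≤⟨ +-mono-≤ (count≤ (adj G x)) (sum-mono {suc n} λ u → drop (adj G x u) (isFinal (kind u))) ⟩
    N                                 ≡⟨ m≡m%n+[m/n]*n N q ⟩
    N % q + N / q * q                 ≤⟨ +-monoˡ-≤ (N / q * q) (m%n≤n N q) ⟩
    k₀ * q                            ≤⟨ *-monoˡ-≤ q (m≤m+n k₀ (relayRank x)) ⟩
    (k₀ + relayRank x) * q            ≡⟨ *-comm (k₀ + relayRank x) q ⟩
    relayTarget x                     ∎
    where
    open ≤-Reasoning
    N : ℕ
    N = suc n + number isFinal
    drop : ∀ a b → 𝟙 (a ∧ b) ≤ 𝟙 b
    drop true  b = ≤-refl
    drop false b = z≤n

  -- The main neighbours can contribute D `degreeTo isMain` ≥ p ≥ n, which covers the order n inside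
  -- `k₀`. The final vertices, the rounding q and the spread of the ranks are covered by `degree≥`.
  relayTarget-upper : ∀ x → isRelay (kind x) ≡ true → relayTarget x ≤ degree G x + degreeTo isMain x * D
  relayTarget-upper x eq = begin
    q * (k₀ + relayRank x)                        ≤⟨ *-monoʳ-≤ q (+-monoʳ-≤ k₀ (<⇒≤ (rank<count (isRelay ∘ kind) x eq))) ⟩
    q * (suc (N / q) + number isRelay)            ≡⟨ lemma q (N / q) (number isRelay) ⟩
    N / q * q + (q + q * number isRelay)          ≤⟨ +-monoˡ-≤ (q + q * number isRelay) (m/n*n≤m N q) ⟩
    suc n + number isFinal + (q + q * number isRelay) ≡⟨ lemma′ (suc n) (number isFinal) q (q * number isRelay) ⟩
    number isFinal + q + q * number isRelay + suc n ≤⟨ +-mono-≤ (degree≥ x) (≤-trans n≤p (≤-trans (toMain x) (≤-reflexive (*-comm D _)))) ⟩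
    degree G x + degreeTo isMain x * D            ∎
    where
    open ≤-Reasoning
    N : ℕ
    N = suc n + number isFinal
    lemma : ∀ q d r → q * (suc d + r) ≡ d * q + (q + q * r)
    lemma = solve-∀
    lemma′ : ∀ a b c d → a + b + (c + d) ≡ b + c + d + a
    lemma′ = solve-∀

  α-supply = supply isRelay isMain D (λ x → relayTarget x ∸ (degree G x + degreeTo isFinal x))
    λ x eq → ≤-trans (∸-monoʳ-≤ (relayTarget x) (m≤m+n (degree G x) _))
      (m≤n+o⇒m∸n≤o (relayTarget x) (degree G x) (relayTarget-upper x eq))

  α : V → V → ℕ
  α = proj₁ α-supply

  α≤ : ∀ u v → α u v ≤ 𝟙 (link isRelay isMain u v) * D
  α≤ = proj₁ (proj₂ α-supply)

  α-row : ∀ x → isRelay (kind x) ≡ true → degree G x + degreeTo isFinal x + sumFin (α x) ≡ relayTarget x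
  α-row x eq = trans (cong (degree G x + degreeTo isFinal x +_) (proj₂ (proj₂ α-supply) x eq))
    (m+[n∸m]≡n (relayTarget-lower x))

  start : V → ℕ
  start a = degree G a + sumFin (λ x → α x a)

  start< : ∀ a → start a + D * suc n < suc (suc n + 2 * (suc n * D))
  start< a = s≤s (begin
    degree G a + sumFin (λ x → α x a) + D * suc n   ≤⟨ +-monoˡ-≤ (D * suc n) (+-mono-≤ (count≤ (adj G a)) (sum-≤-const λ x → ≤-trans (α≤ x a) (≤-trans (*-monoˡ-≤ D (𝟙≤1 (link isRelay isMain x a))) (≤-reflexive (*-identityˡ D))))) ⟩
    suc n + suc n * D + D * suc n                   ≡⟨ lemma (suc n) D ⟩
    suc n + 2 * (suc n * D)                         ∎)
    where
    open ≤-Reasoning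
    lemma : ∀ n D → n + n * D + D * n ≡ n + 2 * (n * D)
    lemma = solve-∀

  open Spreading D L (suc (suc n + 2 * (suc n * D))) p l M T
    (λ v u → adj G v u ∧ isMain (kind u)) (isMain ∘ kind) start toMain start< tests≤ T-large

  colour : V → V
  colour = proj₁ spreading

  σ block : V → ℕ
  σ a = level colour a
  block a = σ a / L

  peers : ℕ → V → Bool
  peers J a = isMain (kind a) ∧ (block a ≡ᵇ J)

  σ< : ∀ a → σ a < suc (suc n + 2 * (suc n * D))
  σ< a = ≤-<-trans (+-monoʳ-≤ (start a) (*-monoʳ-≤ D (count≤ (λ u → (adj G a u ∧ isMain (kind u)) ∧ (suc n ≤ᵇ toℕ (colour u) + toℕ (colour a)))))) (start< a)

  -- A block of length L = q (T + 1) has (T + 1) q′ members with residue at least 3. `density` says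
  -- exactly that the bound of `spreading` does not exceed this number.
  block-size : ∀ a → count (peers (block a)) ≤ suc T * q′
  block-size a = *-cancelˡ-≤ p {{>-nonZero (≤-trans (s≤s z≤n) n≤p)}}
    (≤-trans (proj₂ spreading (block a) (≤-<-trans (m/n≤m (σ a) L) (σ< a))) density)

  peerRank : V → ℕ
  peerRank a = rank (peers (block a)) a

  self-peer : ∀ a → isMain (kind a) ≡ true → peers (block a) a ≡ true
  self-peer a eq = cong₂ _∧_ eq (≡ᵇ-refl (block a))

  peerRank< : ∀ a → isMain (kind a) ≡ true → peerRank a < suc T * q′
  peerRank< a eq = <-≤-trans (rank<count (peers (block a)) a (self-peer a eq)) (block-size a)

  -- The rank among the vertices of the same block is split by q′ into a slot and a residue, which
  -- enumerates the values of residue at least 3. They are taken from the next block, so that the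
  -- target is never below `σ`.
  mainSlot mainResidue mainTarget : V → ℕ
  mainSlot a    = suc T * suc (block a) + peerRank a / q′
  mainResidue a = 3 + peerRank a % q′
  mainTarget a  = q * mainSlot a + mainResidue a

  mainResidue< : ∀ a → mainResidue a < q
  mainResidue< a = +-monoʳ-< 3 (m%n<n (peerRank a) q′)

  mainTarget-lower : ∀ a → σ a ≤ mainTarget a
  mainTarget-lower a = begin
    σ a                                        ≡⟨ m≡m%n+[m/n]*n (σ a) L ⟩
    σ a % L + block a * L                      ≤⟨ +-monoˡ-≤ (block a * L) (m%n≤n (σ a) L) ⟩
    suc (block a) * (q * suc T)                ≡⟨ lemma (suc (block a)) q (suc T) ⟩
    q * (suc T * suc (block a))                ≤⟨ *-monoʳ-≤ q (m≤m+n (suc T * suc (block a)) (peerRank a / q′)) ⟩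
    q * mainSlot a                             ≤⟨ m≤m+n (q * mainSlot a) (mainResidue a) ⟩
    mainTarget a                               ∎
    where
    open ≤-Reasoning
    lemma : ∀ a b c → a * (b * c) ≡ b * (c * a)
    lemma = solve-∀

  -- The lift passes through at most the own block and the next one; `toFinal` supplies 2 L final
  -- neighbours, one unit each.
  mainTarget-upper : ∀ a → isMain (kind a) ≡ true → mainTarget a ≤ σ a + 2 * L
  mainTarget-upper a eq = begin
    q * (suc T * suc (block a) + peerRank a / q′) + mainResidue a
      ≤⟨ +-monoʳ-≤ (q * mainSlot a) (<⇒≤ (mainResidue< a)) ⟩
    q * (suc T * suc (block a) + peerRank a / q′) + q
      ≡⟨ lemma₁ q (suc T) (block a) (peerRank a / q′) ⟩
    block a * L + (L + q * suc (peerRank a / q′))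
      ≤⟨ +-mono-≤ (m/n*n≤m (σ a) L) (+-monoʳ-≤ L (*-monoʳ-≤ q (slots-divide (suc T) q′ (peerRank a) (peerRank< a eq)))) ⟩
    σ a + (L + L)
      ≡⟨ cong (λ x → σ a + (L + x)) (+-identityʳ L) ⟨
    σ a + 2 * L ∎
    where
    open ≤-Reasoning
    lemma₁ : ∀ q T b r → q * (T * suc b + r) + q ≡ b * (q * T) + (q * T + q * suc r)
    lemma₁ = solve-∀

  γ-supply = supply isMain isFinal 1 (λ a → mainTarget a ∸ σ a)
    λ a eq → ≤-trans (m≤n+o⇒m∸n≤o (mainTarget a) (σ a) (mainTarget-upper a eq))
      (≤-trans (toFinal a) (≤-reflexive (≡.sym (*-identityʳ (degreeTo isFinal a)))))

  γ : V → V → ℕ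
  γ = proj₁ γ-supply

  γ≤ : ∀ u v → γ u v ≤ 𝟙 (link isMain isFinal u v) * 1
  γ≤ = proj₁ (proj₂ γ-supply)

  γ-row : ∀ a → isMain (kind a) ≡ true → σ a + sumFin (γ a) ≡ mainTarget a
  γ-row a eq = trans (cong (σ a +_) (proj₂ (proj₂ γ-supply) a eq)) (m+[n∸m]≡n (mainTarget-lower a))

  -- The base of a final vertex contains the lifts `γ`, which are settled by now. Only final-relay
  -- edges remain to be chosen, so the main vertices keep their targets.
  toggled : Toggling q (link isFinal isRelay) (isFinal ∘ kind) (λ b → degree G b + sumFin (λ a → γ a b)) [] (λ _ → false)
  toggled = toggling q (link isFinal isRelay) (isFinal ∘ kind) _ [] _ (s≤s (s≤s z≤n)) room
    where
    room : ∀ b → isFinal (kind b) ≡ true → q * suc (number isFinal) ≤ count (link isFinal isRelay b)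
    room b eq rewrite eq = toRelay b

  open Toggling toggled using (ε; s′; slot) renaming (ε-range to ε≤)

  θ : V → V → ℕ
  θ u v = 𝟙 (link isMain isMain u v ∧ (suc n ≤ᵇ toℕ (colour v) + toℕ (colour u))) * D

  θ≤ : ∀ u v → θ u v ≤ 𝟙 (link isMain isMain u v) * D
  θ≤ u v = *-monoˡ-≤ D (keep (link isMain isMain u v) _)
    where
    keep : ∀ a b → 𝟙 (a ∧ b) ≤ 𝟙 a
    keep false b = z≤n
    keep true  b = 𝟙≤1 b

  link-sym : ∀ P u v → link P P u v ≡ link P P v u
  link-sym P u v rewrite sym G u v = swap (P (kind u)) (adj G v u) (P (kind v))
    where
    swap : ∀ a b c → a ∧ (b ∧ c) ≡ c ∧ (b ∧ a)
    swap false b c rewrite ∧-zeroʳ b = ≡.sym (∧-zeroʳ c)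
    swap true  false c = ≡.sym (∧-zeroʳ c)
    swap true  true  false = refl
    swap true  true  true  = refl

  θ-sym : ∀ u v → θ u v ≡ θ v u
  θ-sym u v = cong₂ (λ b x → 𝟙 (b ∧ (suc n ≤ᵇ x)) * D) (link-sym isMain u v) (+-comm (toℕ (colour v)) (toℕ (colour u)))

  θ-row : ∀ a → isMain (kind a) ≡ true → sumFin (θ a) ≡ D * hits colour a
  θ-row a eq = trans (sum-*ʳ D hit) (trans (*-comm (sumFin hit) D) (cong (D *_) (sum-cong {suc n} λ v → cong (λ b → 𝟙 ((b ∧ (adj G a v ∧ isMain (kind v))) ∧ (suc n ≤ᵇ toℕ (colour v) + toℕ (colour a)))) eq)))
    where
    hit : V → ℕ
    hit v = 𝟙 (link isMain isMain a v ∧ (suc n ≤ᵇ toℕ (colour v) + toℕ (colour a)))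

  -- `α`, `γ` and `ε` are directed from rows to columns, so both directions are added; `θ` is
  -- symmetric already.
  extra : V → V → ℕ
  extra u v = θ u v + ((α u v + α v u) + ((γ u v + γ v u) + (ε u v + ε v u)))

  extra-sym : ∀ u v → extra u v ≡ extra v u
  extra-sym u v = cong₂ _+_ (θ-sym u v) (cong₂ _+_ (+-comm (α u v) _) (cong₂ _+_ (+-comm (γ u v) _) (+-comm (ε u v) _)))

  Σ-extra : ∀ u → sumFin (extra u) ≡ sumFin (θ u) + ((sumFin (α u) + sumFin (λ v → α v u)) +
    ((sumFin (γ u) + sumFin (λ v → γ v u)) + (sumFin (ε u) + sumFin (λ v → ε v u))))
  Σ-extra u = trans (sum-+ (θ u) (λ v → (α u v + α v u) + ((γ u v + γ v u) + (ε u v + ε v u)))) (cong (sumFin (θ u) +_)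
    (trans (sum-+ (λ v → α u v + α v u) (λ v → (γ u v + γ v u) + (ε u v + ε v u))) (cong₂ _+_ (sum-+ (α u) (λ v → α v u))
    (trans (sum-+ (λ v → γ u v + γ v u) (λ v → ε u v + ε v u)) (cong₂ _+_ (sum-+ (γ u) (λ v → γ v u)) (sum-+ (ε u) (λ v → ε v u)))))))

  extra-nonedge : ∀ u v → adj G u v ≡ false → extra u v ≡ 0
  extra-nonedge u v eq = cong₂ _+_ (supported (θ≤ u v) (link-edge isMain isMain u v eq))
    (cong₂ _+_ (cong₂ _+_ (supported (α≤ u v) (link-edge isRelay isMain u v eq))
                          (supported (α≤ v u) (link-edge isRelay isMain v u eq′)))
    (cong₂ _+_ (cong₂ _+_ (supported (γ≤ u v) (link-edge isMain isFinal u v eq))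
                          (supported (γ≤ v u) (link-edge isMain isFinal v u eq′)))
               (cong₂ _+_ (supported (ε≤ u v) (link-edge isFinal isRelay u v eq))
                          (supported (ε≤ v u) (link-edge isFinal isRelay v u eq′)))))
    where
    eq′ : adj G v u ≡ false
    eq′ = trans (sym G v u) eq

  -- The kinds of u and v support at most one of the seven summands (`one`), and each is at most D.
  -- For `ε`, which reaches 2, this uses 2 ≤ D.
  extra≤D : ∀ u v → extra u v ≤ D
  extra≤D u v = begin
    extra u v
      ≤⟨ +-mono-≤ (term isMain isMain (θ≤ u v) ≤-refl) (+-mono-≤ (+-mono-≤ (term isRelay isMain (α≤ u v) ≤-refl) (term′ isRelay isMain (α≤ v u) ≤-refl))
          (+-mono-≤ (+-mono-≤ (term isMain isFinal (γ≤ u v) 1≤D) (term′ isMain isFinal (γ≤ v u) 1≤D))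
                    (+-mono-≤ (term isFinal isRelay (ε≤ u v) 2≤D) (term′ isFinal isRelay (ε≤ v u) 2≤D)))) ⟩
    χ isMain isMain * D + ((χ isRelay isMain * D + χ′ isRelay isMain * D) + ((χ isMain isFinal * D + χ′ isMain isFinal * D) + (χ isFinal isRelay * D + χ′ isFinal isRelay * D)))
      ≡⟨ collect (χ isMain isMain) (χ isRelay isMain) (χ′ isRelay isMain) (χ isMain isFinal) (χ′ isMain isFinal) (χ isFinal isRelay) (χ′ isFinal isRelay) D ⟩
    (χ isMain isMain + (χ isRelay isMain + χ′ isRelay isMain + (χ isMain isFinal + χ′ isMain isFinal + (χ isFinal isRelay + χ′ isFinal isRelay)))) * D
      ≤⟨ *-monoˡ-≤ D (one (kind u) (kind v)) ⟩
    1 * D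
      ≡⟨ *-identityˡ D ⟩
    D ∎
    where
    open ≤-Reasoning
    1≤D : 1 ≤ D
    1≤D = ≤-trans (s≤s z≤n) 2≤D
    χ χ′ : (Kind → Bool) → (Kind → Bool) → ℕ
    χ  P Q = 𝟙 (P (kind u) ∧ Q (kind v))
    χ′ P Q = 𝟙 (P (kind v) ∧ Q (kind u))
    shrink : ∀ a b c {x k} → x ≤ 𝟙 (a ∧ (b ∧ c)) * k → k ≤ D → x ≤ 𝟙 (a ∧ c) * D
    shrink false b     c x≤ k≤D = x≤
    shrink true  false c x≤ k≤D = ≤-trans x≤ z≤n
    shrink true  true  c x≤ k≤D = ≤-trans x≤ (*-monoʳ-≤ (𝟙 c) k≤D)
    term : ∀ P Q {x k} → x ≤ 𝟙 (link P Q u v) * k → k ≤ D → x ≤ χ P Q * D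
    term P Q = shrink (P (kind u)) (adj G u v) (Q (kind v))
    term′ : ∀ P Q {x k} → x ≤ 𝟙 (link P Q v u) * k → k ≤ D → x ≤ χ′ P Q * D
    term′ P Q = shrink (P (kind v)) (adj G v u) (Q (kind u))
    collect : ∀ a b c d e f g D → a * D + ((b * D + c * D) + ((d * D + e * D) + (f * D + g * D))) ≡ (a + (b + c + (d + e + (f + g)))) * D
    collect = solve-∀
    one : ∀ k k′ → 𝟙 (isMain k ∧ isMain k′) + (𝟙 (isRelay k ∧ isMain k′) + 𝟙 (isRelay k′ ∧ isMain k) +
      (𝟙 (isMain k ∧ isFinal k′) + 𝟙 (isMain k′ ∧ isFinal k) + (𝟙 (isFinal k ∧ isRelay k′) + 𝟙 (isFinal k′ ∧ isRelay k)))) ≤ 1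
    one main  main  = ≤-refl
    one main  relay = ≤-refl
    one main  final = ≤-refl
    one relay main  = ≤-refl
    one relay relay = z≤n
    one relay final = ≤-refl
    one final main  = ≤-refl
    one final relay = ≤-refl
    one final final = z≤n

  weighting : Weighting G (suc D)
  weighting = record
    { w       = λ u v → suc (extra u v)
    ; w-sym   = λ u v _ → cong suc (extra-sym u v)
    ; w-range = λ u v _ → s≤s z≤n , s≤s (extra≤D u v)
    }

  wdeg-extra : ∀ u → wdeg weighting u ≡ degree G u + sumFin (extra u)
  wdeg-extra u = trans (sum-cong pointwise) (sum-+ (𝟙 ∘ adj G u) (extra u))
    where
    pointwise : ∀ v → (if adj G u v then suc (extra u v) else 0) ≡ 𝟙 (adj G u v) + extra u v
    pointwise v = on-edges (adj G u v) (extra-nonedge u v)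
      where
      on-edges : ∀ b {x} → (b ≡ false → x ≡ 0) → (if b then suc x else 0) ≡ 𝟙 b + x
      on-edges true  _  = refl
      on-edges false x≡0 = ≡.sym (x≡0 refl)

  quotient residue : Kind → V → ℕ
  quotient main  = mainSlot
  quotient relay = λ x → k₀ + relayRank x
  quotient final = slot
  residue main  = mainResidue
  residue relay = 𝟙 ∘ s′
  residue final = λ _ → 2

  -- Sums directed between other kinds vanish. What remains is `γ-row` for main vertices, `α-row`
  -- with the column sum for relay vertices, and the row equation of `toggled` for final vertices.
  wdeg-code : ∀ {k} u → kind u ≡ k → wdeg weighting u ≡ q * quotient k u + residue k u
  wdeg-code u ku = trans (wdeg-extra u) (trans (cong (degree G u +_) (Σ-extra u)) (by-kind _ ku))
    where
    θ-zero : isMain (kind u) ≡ false → sumFin (θ u) ≡ 0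
    θ-zero eq = sum-zero {suc n} λ v → supported (θ≤ u v) (link-left isMain isMain u v eq)
    αˡ-zero : isRelay (kind u) ≡ false → sumFin (α u) ≡ 0
    αˡ-zero eq = sum-zero {suc n} λ v → supported (α≤ u v) (link-left isRelay isMain u v eq)
    αʳ-zero : isMain (kind u) ≡ false → sumFin (λ v → α v u) ≡ 0
    αʳ-zero eq = sum-zero {suc n} λ v → supported (α≤ v u) (link-right isRelay isMain v u eq)
    γˡ-zero : isMain (kind u) ≡ false → sumFin (γ u) ≡ 0
    γˡ-zero eq = sum-zero {suc n} λ v → supported (γ≤ u v) (link-left isMain isFinal u v eq)
    γʳ-zero : isFinal (kind u) ≡ false → sumFin (λ v → γ v u) ≡ 0
    γʳ-zero eq = sum-zero {suc n} λ v → supported (γ≤ v u) (link-right isMain isFinal v u eq)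
    εˡ-zero : isFinal (kind u) ≡ false → sumFin (ε u) ≡ 0
    εˡ-zero eq = sum-zero {suc n} λ v → supported (ε≤ u v) (link-left isFinal isRelay u v eq)
    εʳ-zero : isRelay (kind u) ≡ false → sumFin (λ v → ε v u) ≡ 0
    εʳ-zero eq = sum-zero {suc n} λ v → supported (ε≤ v u) (link-right isFinal isRelay v u eq)
    combine : ∀ d {t t′ a a′ b b′ c c′ e e′ f f′ g g′} → t ≡ t′ → a ≡ a′ → b ≡ b′ → c ≡ c′ → e ≡ e′ → f ≡ f′ → g ≡ g′ →
      d + (t + ((a + b) + ((c + e) + (f + g)))) ≡ d + (t′ + ((a′ + b′) + ((c′ + e′) + (f′ + g′))))
    combine _ refl refl refl refl refl refl refl = refl
    by-kind : ∀ k → kind u ≡ k → degree G u + (sumFin (θ u) + ((sumFin (α u) + sumFin (λ v → α v u)) +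
      ((sumFin (γ u) + sumFin (λ v → γ v u)) + (sumFin (ε u) + sumFin (λ v → ε v u))))) ≡ q * quotient k u + residue k u
    by-kind main ku = trans
      (combine (degree G u) (θ-row u (cong isMain ku)) (αˡ-zero (cong isRelay ku)) refl refl (γʳ-zero (cong isFinal ku))
               (εˡ-zero (cong isFinal ku)) (εʳ-zero (cong isRelay ku)))
      (trans (lemma (degree G u) (D * hits colour u) (sumFin (λ x → α x u)) (sumFin (γ u))) (γ-row u (cong isMain ku)))
      where
      lemma : ∀ a b c d → a + (b + (c + ((d + 0) + 0))) ≡ a + c + b + d
      lemma = solve-∀
    by-kind relay ku = trans
      (combine (degree G u) (θ-zero (cong isMain ku)) (refl {x = sumFin (α u)}) (αʳ-zero (cong isMain ku)) (γˡ-zero (cong isMain ku))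
               (γʳ-zero (cong isFinal ku)) (εˡ-zero (cong isFinal ku)) column)
      (trans (lemma (degree G u) (sumFin (α u)) (degreeTo isFinal u) (𝟙 (s′ u)))
             (cong (_+ 𝟙 (s′ u)) (α-row u (cong isRelay ku))))
      where
      lemma : ∀ a b c d → a + (b + 0 + (c + d)) ≡ a + c + b + d
      lemma = solve-∀
      swap : ∀ a b → a ∧ (b ∧ true) ≡ b ∧ a
      swap false false = refl
      swap false true  = refl
      swap true  false = refl
      swap true  true  = refl
      reindex : ∀ b → 𝟙 (link isFinal isRelay b u) ≡ 𝟙 (adj G u b ∧ isFinal (kind b))
      reindex b = trans (cong₂ (λ x y → 𝟙 (isFinal (kind b) ∧ (x ∧ isRelay y))) (sym G b u) ku)
        (cong 𝟙 (swap (isFinal (kind b)) (adj G u b)))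
      column : sumFin (λ b → ε b u) ≡ degreeTo isFinal u + 𝟙 (s′ u)
      -- All states start as false, so only the last state `s′` is added to the number of final
      -- neighbours.
      column = trans (≡.sym (+-identityʳ (sumFin (λ b → ε b u)))) (trans (Toggling.column toggled u) (cong (_+ 𝟙 (s′ u)) (sum-cong {suc n} reindex)))
    by-kind final ku = trans
      (combine (degree G u) (θ-zero (cong isMain ku)) (αˡ-zero (cong isRelay ku)) (αʳ-zero (cong isMain ku)) (γˡ-zero (cong isMain ku))
               refl refl (εʳ-zero (cong isRelay ku)))
      (trans (lemma (degree G u) (sumFin (λ a → γ a u)) (sumFin (ε u))) (Toggling.row toggled u (cong isFinal ku)))
      where
      lemma : ∀ a b c → a + (b + (c + 0)) ≡ a + b + c
      lemma = solve-∀

  residue< : ∀ k u → residue k u < q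
  residue< main  u = mainResidue< u
  residue< relay u = s≤s (≤-trans (𝟙≤1 (s′ u)) (s≤s z≤n))
  residue< final u = s≤s (s≤s (s≤s z≤n))

  -- Division of the slot by T + 1 recovers the block and the quotient of the rank by q′; the
  -- residue gives the remainder. Block and rank determine the vertex.
  main-injective : ∀ u v → isMain (kind u) ≡ true → isMain (kind v) ≡ true →
    mainSlot u ≡ mainSlot v → mainResidue u ≡ mainResidue v → u ≡ v
  main-injective u v mu mv slot≡ residue≡ = rank-injective (peers (block u)) u v (self-peer u mu)
    (subst (λ J → peers J v ≡ true) (≡.sym block≡) (self-peer v mv))
    (trans rank≡ (cong (λ J → rank (peers J) v) (≡.sym block≡)))
    where
    halves = quotient-remainder-unique (suc T) (suc (block u)) (peerRank u / q′) (suc (block v)) (peerRank v / q′)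
      (slots-divide (suc T) q′ (peerRank u) (peerRank< u mu)) (slots-divide (suc T) q′ (peerRank v) (peerRank< v mv)) slot≡
    block≡ : block u ≡ block v
    block≡ = suc-injective (proj₁ halves)
    rank≡ : peerRank u ≡ peerRank v
    rank≡ = trans (m≡m%n+[m/n]*n (peerRank u) q′)
      (trans (cong₂ (λ r d → r + d * q′) (+-cancelˡ-≡ 3 _ _ residue≡) (proj₂ halves)) (≡.sym (m≡m%n+[m/n]*n (peerRank v) q′)))

  -- Residues separate the kinds: 0 or 1 for relay, 2 for final and at least 3 for main vertices.
  -- Within the relay or the final kind the quotient decides alone.
  code-injective : ∀ k k′ u v → kind u ≡ k → kind v ≡ k′ →
    quotient k u ≡ quotient k′ v → residue k u ≡ residue k′ v → u ≡ v
  code-injective main  main  u v ku kv q≡ r≡ = main-injective u v (cong isMain ku) (cong isMain kv) q≡ r≡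
  code-injective relay relay u v ku kv q≡ r≡ =
    rank-injective (isRelay ∘ kind) u v (cong isRelay ku) (cong isRelay kv) (+-cancelˡ-≡ k₀ _ _ q≡)
  code-injective final final u v ku kv q≡ r≡ =
    Toggling.slot-unique toggled u v (cong isFinal ku) (cong isFinal kv) q≡
  code-injective main  final u v ku kv q≡ ()
  code-injective final main  u v ku kv q≡ ()
  code-injective main  relay u v ku kv q≡ r≡ = contradiction (≡.sym r≡) (𝟙≢2+ (s′ v))
  code-injective relay main  u v ku kv q≡ r≡ = contradiction r≡ (𝟙≢2+ (s′ u))
  code-injective relay final u v ku kv q≡ r≡ = contradiction r≡ (𝟙≢2+ (s′ u))
  code-injective final relay u v ku kv q≡ r≡ = contradiction (≡.sym r≡) (𝟙≢2+ (s′ v))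

  irregular : IrrStrengthAtMost G (suc D)
  irregular = weighting , λ u v eq →
    let q≡ , r≡ = quotient-remainder-unique q _ _ _ _ (residue< (kind u) u) (residue< (kind v) v)
                    (trans (≡.sym (wdeg-code u refl)) (trans eq (wdeg-code v refl)))
    in code-injective (kind u) (kind v) u v refl refl q≡ r≡

-- The random partition into kinds.

record Partition {n} (G : Graph n) (W T : ℕ) : Set where
  field
    kind : Fin n → Kind
  open Links G kind
  field
    relays≤ : 4 * W * number isRelay ≤ n + 4 * W * T
    finals≤ : 8 * (W * W) * number isFinal ≤ n + 8 * (W * W) * T
    relays≥ : ∀ v → degree G v ≤ 4 * W * degreeTo isRelay v + 4 * W * T
    finals≥ : ∀ v → degree G v ≤ 8 * (W * W) * degreeTo isFinal v + 8 * (W * W) * T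

-- A colour in Fin (8W²) is drawn for every vertex; colour 0 makes it final, the last 2W colours make it a relay.
partition : ∀ {n} (G : Graph n) W T l M .{{_ : NonZero W}} .{{_ : NonZero M}} →
  suc n * 4 ≤ 2 ^ l → n + l * (M * M) ≤ M * T → Partition G W T
partition {n} G W T l M tests≤ T-large = record
  { kind    = kindOf ∘ c
  ; relays≤ = *-cancelˡ-≤ (2 * W) (begin
      2 * W * (4 * W * count (λ u → isRelay (kindOf (c u))))  ≡⟨ regroup W _ ⟩
      m * count (λ u → isRelay (kindOf (c u)))                ≤⟨ upper zero isRelay (2 * W) relay-few (bound (zero , zero)) ⟩
      count (λ u → family zero u) * (2 * W) + m * T           ≡⟨ cong (λ x → x * (2 * W) + m * T) all ⟩
      n * (2 * W) + m * T                                     ≡⟨ split W n T ⟩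
      2 * W * (n + 4 * W * T)                                 ∎)
  ; finals≤ = begin
      m * count (λ u → isFinal (kindOf (c u)))                ≤⟨ upper zero isFinal 1 final-few (bound (zero , suc (suc zero))) ⟩
      count (λ u → family zero u) * 1 + m * T                 ≡⟨ cong (_+ m * T) (trans (*-identityʳ _) all) ⟩
      n + m * T                                               ∎
  ; relays≥ = λ v → *-cancelˡ-≤ (2 * W) (begin
      2 * W * degree G v                                      ≡⟨ *-comm (2 * W) (degree G v) ⟩
      degree G v * (2 * W)                                    ≤⟨ lower (suc v) isRelay (2 * W) 2W≤m relay-many (bound (suc v , suc zero)) ⟩
      m * count (λ u → adj G v u ∧ isRelay (kindOf (c u))) + m * T ≡⟨ split′ W _ T ⟩
      2 * W * (4 * W * count (λ u → adj G v u ∧ isRelay (kindOf (c u))) + 4 * W * T) ∎)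
  ; finals≥ = λ v → begin
      degree G v                                              ≡⟨ *-identityʳ (degree G v) ⟨
      degree G v * 1                                          ≤⟨ lower (suc v) isFinal 1 1≤m final-many (bound (suc v , suc (suc (suc zero)))) ⟩
      m * count (λ u → adj G v u ∧ isFinal (kindOf (c u))) + m * T ∎
  }
  where
  open ≤-Reasoning
  m : ℕ
  m = 8 * (W * W)
  instance
    W*W≢0 : NonZero (W * W)
    W*W≢0 = m*n≢0 W W
    m≢0 : NonZero m
    m≢0 = m*n≢0 8 (W * W)
    2W≢0 : NonZero (2 * W)
    2W≢0 = m*n≢0 2 W
  1≤m : 1 ≤ m
  1≤m = >-nonZero⁻¹ m
  2W≤m : 2 * W ≤ m
  2W≤m = *-mono-≤ {2} {8} {W} (s≤s (s≤s z≤n)) (m≤m*n W W)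
  2W≤m∸1 : 2 * W ≤ m ∸ 1
  2W≤m∸1 = m+n≤o⇒m≤o∸n (2 * W) (begin
    2 * W + 1      ≤⟨ +-mono-≤ (*-monoʳ-≤ 2 (m≤m*n W W)) (>-nonZero⁻¹ (W * W)) ⟩
    2 * (W * W) + W * W ≤⟨ m≤m+n _ (5 * (W * W)) ⟩
    2 * (W * W) + W * W + 5 * (W * W) ≡⟨ eight (W * W) ⟩
    m              ∎)
    where
    eight : ∀ x → 2 * x + x + 5 * x ≡ 8 * x
    eight = solve-∀
  high top : Fin m → Bool
  -- `high` means c ≥ 1 and `top` means c ≥ m - 2W, both written in the form that `count-≥` and
  -- `count-<` handle.
  high c = m ≤ᵇ toℕ c + (m ∸ 1)
  top  c = m ≤ᵇ toℕ c + 2 * W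
  kindOf : Fin m → Kind
  kindOf c = if high c then (if top c then relay else main) else final
  relay⇒top : ∀ c → 𝟙 (isRelay (kindOf c)) ≤ 𝟙 (top c)
  relay⇒top c with high c | top c
  ... | true  | true  = ≤-refl
  ... | true  | false = z≤n
  ... | false | _     = z≤n
  top⇒high : ∀ c → top c ≡ true → high c ≡ true
  top⇒high c eq = ≤ᵇ-true (≤-trans (≤ᵇ⇒≤ m (toℕ c + 2 * W) (Equivalence.from T-≡ eq)) (+-monoʳ-≤ (toℕ c) 2W≤m∸1))
  nonrelay⇒nontop : ∀ c → 𝟙 (not (isRelay (kindOf c))) ≤ 𝟙 (not (top c))
  nonrelay⇒nontop c with high c | top c | top⇒high c
  ... | true  | true  | _ = ≤-refl
  ... | true  | false | _ = ≤-refl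
  ... | false | false | _ = ≤-refl
  ... | false | true  | f = contradiction (f refl) λ ()
  final≡ : ∀ c → isFinal (kindOf c) ≡ not (high c)
  final≡ c with high c | top c
  ... | true  | true  = refl
  ... | true  | false = refl
  ... | false | _     = refl
  relay-few : count (isRelay ∘ kindOf) ≤ 2 * W
  relay-few = ≤-trans (sum-mono relay⇒top) (≤-trans (count-≥ m m (2 * W)) (≤-reflexive (m+n∸m≡n m (2 * W))))
  relay-many : count (not ∘ isRelay ∘ kindOf) ≤ m ∸ 2 * W
  relay-many = ≤-trans (sum-mono nonrelay⇒nontop) (count-< m m (2 * W))
  final-few : count (isFinal ∘ kindOf) ≤ 1
  final-few = ≤-trans (≤-reflexive (sum-cong (λ c → cong 𝟙 (final≡ c))))
    (≤-trans (count-< m m (m ∸ 1)) (≤-reflexive (m∸[m∸n]≡n 1≤m)))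
  final-many : count (not ∘ isFinal ∘ kindOf) ≤ m ∸ 1
  final-many = ≤-trans (≤-reflexive (sum-cong (λ c → cong 𝟙 (trans (cong not (final≡ c)) (not-involutive (high c))))))
    (≤-trans (count-≥ m m (m ∸ 1)) (≤-reflexive (m+n∸m≡n m (m ∸ 1))))
  -- The whole vertex set and the n neighbourhoods, each tested against the relay and final colours
  -- and their complements: 4 (n + 1) tests.
  family : Fin (suc n) → Fin n → Bool
  family zero    u = true
  family (suc v) u = adj G v u
  choice : Fin 4 → Fin m → Bool
  choice zero                = isRelay ∘ kindOf
  choice (suc zero)          = not ∘ isRelay ∘ kindOf
  choice (suc (suc zero))    = isFinal ∘ kindOf
  choice (suc (suc (suc _))) = not ∘ isFinal ∘ kindOf
  chosen = chernoff-indexed {M = M} {l = l} {T = T} (*↔× {suc n} {4}) tests≤ T-large (λ (i , k) u c → family i u ∧ choice k c)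
  c : Fin n → Fin m
  c = proj₁ chosen
  bound = proj₂ chosen
  upper : ∀ i (R : Kind → Bool) x → count (R ∘ kindOf) ≤ x →
    m * count (λ u → family i u ∧ R (kindOf (c u))) ≤ sumFin (λ u → count (λ c → family i u ∧ R (kindOf c))) + m * T →
    m * count (λ u → family i u ∧ R (kindOf (c u))) ≤ count (family i) * x + m * T
  upper i R = discrepancy-upper T (family i) (R ∘ kindOf) c
  lower : ∀ i (R : Kind → Bool) x → x ≤ m → count (not ∘ R ∘ kindOf) ≤ m ∸ x →
    m * count (λ u → family i u ∧ not (R (kindOf (c u)))) ≤ sumFin (λ u → count (λ c → family i u ∧ not (R (kindOf c)))) + m * T →
    count (family i) * x ≤ m * count (λ u → family i u ∧ R (kindOf (c u))) + m * T
  lower i R = discrepancy-lower T (family i) (R ∘ kindOf) c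
  all : count (family zero) ≡ n
  all = trans (sum-const n 1) (*-identityʳ n)
  regroup : ∀ W x → 2 * W * (4 * W * x) ≡ 8 * (W * W) * x
  regroup = solve-∀
  split : ∀ W n T → n * (2 * W) + 8 * (W * W) * T ≡ 2 * W * (n + 4 * W * T)
  split = solve-∀
  split′ : ∀ W x T → 8 * (W * W) * x + 8 * (W * W) * T ≡ 2 * W * (4 * W * x + 4 * W * T)
  split′ = solve-∀

-- Choice of the parameters.

degree-split : ∀ {n} (G : Graph n) (kind : Fin n → Kind) v → let open Links G kind in
  degree G v ≤ degreeTo isMain v + (number isRelay + number isFinal)
degree-split G kind v = ≤-trans (sum-mono λ u → pointwise (adj G v u) (kind u))
  (≤-reflexive (trans (sum-+ (λ u → 𝟙 (adj G v u ∧ isMain (kind u))) (λ u → 𝟙 (isRelay (kind u)) + 𝟙 (isFinal (kind u))))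
    (cong (degreeTo isMain v +_) (sum-+ (𝟙 ∘ isRelay ∘ kind) (𝟙 ∘ isFinal ∘ kind)))))
  where
  open Links G kind
  pointwise : ∀ b k → 𝟙 b ≤ 𝟙 (b ∧ isMain k) + (𝟙 (isRelay k) + 𝟙 (isFinal k))
  pointwise false k     = z≤n
  pointwise true  main  = ≤-refl
  pointwise true  relay = ≤-refl
  pointwise true  final = ≤-refl

power-of-two-bracket : ∀ n .{{_ : NonZero n}} → ∃ λ l → 2 ^ l ≤ n × n < 2 ^ suc l
power-of-two-bracket (suc zero) = 0 , s≤s z≤n , s≤s (s≤s z≤n)
power-of-two-bracket (suc (suc n)) with power-of-two-bracket (suc n)
... | l , ≤n , n< with suc (suc n) <? 2 ^ suc l
...   | yes n+1< = l , ≤-trans ≤n (n≤1+n _) , n+1<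
...   | no  n+1≮ = suc l , ≮⇒≥ n+1≮ , (begin-strict
  suc (suc n)       ≤⟨ n< ⟩
  2 ^ suc l         <⟨ ^-monoʳ-< 2 (s≤s (s≤s z≤n)) (n<1+n (suc l)) ⟩
  2 ^ suc (suc l)   ∎)
  where open ≤-Reasoning

-- a is the surplus of D times the degree over n. With M = 2X and T about n/X the two error terms n
-- and 6 l M² are each at most X T, half of M T. The condition X ≥ 80 W³ makes 40 W³ T ≤ n, and this
-- single inequality pays for every sampling error.
parameters : ∀ {n} (G : Graph n) D q′ X l a {{_ : NonZero n}} {{_ : NonZero q′}} →
  let q = 3 + q′; W = D * q in
  2 ≤ D → 1 ≤ l → n ≤ 2 ^ suc l → (∀ v → n + a ≤ D * degree G v) → n + a ≤ D * n →
  (1 + 6 * D) * n ≤ q * a → 80 * (W * (W * W)) ≤ X → 24 * (l * (X * X)) ≤ n → Parameters G D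
parameters {n} G D q′ X l a 2≤D 1≤l n≤ mindeg na≤Dn a-large X-large n-large = record
  { kind = kind ; q′ = q′ ; T = T ; l = 6 * l ; M = M ; p = p
  ; 2≤D = 2≤D ; n≤p = n≤p ; toMain = toMain ; toRelay = toRelay ; toFinal = toFinal
  ; degree≥ = degree≥ ; density = density ; tests≤ = tests≤ ; T-large = T-large }
  where
  open ≤-Reasoning
  q W T M t : ℕ
  q = 3 + q′
  W = D * q
  instance
    D≢0 : NonZero D
    D≢0 = >-nonZero (≤-trans (s≤s z≤n) 2≤D)
    W≢0 : NonZero W
    W≢0 = m*n≢0 D q
    WW≢0 : NonZero (W * W)
    WW≢0 = m*n≢0 W W
    W*D≢0 : NonZero (W * D)
    W*D≢0 = m*n≢0 W D
    WWW≢0 : NonZero (W * (W * W))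
    WWW≢0 = m*n≢0 W (W * W)
    X≢0 : NonZero X
    X≢0 = >-nonZero (≤-trans (>-nonZero⁻¹ (80 * (W * (W * W))) {{m*n≢0 80 (W * (W * W))}}) X-large)
    M≢0 : NonZero (2 * X)
    M≢0 = m*n≢0 2 X
    l≢0 : NonZero l
    l≢0 = >-nonZero 1≤l
  T = suc (n / X)
  M = 2 * X
  t = W * (W * W) * T

  X≤n : X ≤ n
  X≤n = begin
    X                    ≤⟨ m≤m*n X X ⟩
    X * X                ≤⟨ m≤n*m (X * X) l ⟩
    l * (X * X)          ≤⟨ m≤n*m (l * (X * X)) 24 ⟩
    24 * (l * (X * X))   ≤⟨ n-large ⟩
    n                    ∎

  n≤XT : n ≤ X * T
  n≤XT = begin
    n                      ≡⟨ m≡m%n+[m/n]*n n X ⟩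
    n % X + n / X * X      ≤⟨ +-monoˡ-≤ (n / X * X) (m%n≤n n X) ⟩
    T * X                  ≡⟨ *-comm T X ⟩
    X * T                  ∎

  40t≤n : 40 * t ≤ n
  40t≤n = *-cancelˡ-≤ 2 (begin
    2 * (40 * t)                ≡⟨ lemma (W * (W * W)) T ⟩
    80 * (W * (W * W)) * T      ≤⟨ *-monoˡ-≤ T X-large ⟩
    X * suc (n / X)             ≡⟨ *-comm X (suc (n / X)) ⟩
    X + n / X * X               ≤⟨ +-mono-≤ X≤n (m/n*n≤m n X) ⟩
    n + n                       ≡⟨ cong (n +_) (+-identityʳ n) ⟨
    2 * n                       ∎)
    where
    lemma : ∀ x T → 2 * (40 * (x * T)) ≡ 80 * x * T
    lemma = solve-∀

  T-large : n + 6 * l * (M * M) ≤ M * T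
  T-large = begin
    n + 6 * l * (M * M)         ≡⟨ cong (n +_) (lemma l X) ⟩
    n + 24 * (l * (X * X))      ≤⟨ +-mono-≤ n≤XT (≤-trans n-large n≤XT) ⟩
    X * T + X * T               ≡⟨ lemma′ X T ⟩
    M * T                       ∎
    where
    lemma : ∀ l X → 6 * l * (2 * X * (2 * X)) ≡ 24 * (l * (X * X))
    lemma = solve-∀
    lemma′ : ∀ X T → X * T + X * T ≡ 2 * X * T
    lemma′ = solve-∀

  -- Both families of tests have at most 4 n² members. From n ≤ 2^(l + 1) the exponent needed is 2 l
  -- + 4, which is at most 6 l as l ≥ 1.
  4nn≤ : 4 * (n * n) ≤ 2 ^ (6 * l)
  4nn≤ = begin
    4 * (n * n)                          ≤⟨ *-monoʳ-≤ 4 (*-mono-≤ n≤ n≤) ⟩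
    2 ^ 2 * (2 ^ suc l * 2 ^ suc l)      ≡⟨ cong (2 ^ 2 *_) (^-distribˡ-+-* 2 (suc l) (suc l)) ⟨
    2 ^ 2 * 2 ^ (suc l + suc l)          ≡⟨ ^-distribˡ-+-* 2 2 (suc l + suc l) ⟨
    2 ^ (2 + (suc l + suc l))            ≤⟨ ^-monoʳ-≤ 2 exponents ⟩
    2 ^ (6 * l)                          ∎
    where
    lemma : ∀ l → 2 + (suc l + suc l) ≡ 4 * 1 + 2 * l
    lemma = solve-∀
    lemma′ : ∀ l → 4 * l + 2 * l ≡ 6 * l
    lemma′ = solve-∀
    exponents : 2 + (suc l + suc l) ≤ 6 * l
    exponents = begin
      2 + (suc l + suc l) ≡⟨ lemma l ⟩
      4 * 1 + 2 * l       ≤⟨ +-monoˡ-≤ (2 * l) (*-monoʳ-≤ 4 1≤l) ⟩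
      4 * l + 2 * l       ≡⟨ lemma′ l ⟩
      6 * l               ∎

  2+2D≤n : 2 + 2 * D ≤ n
  2+2D≤n = begin
    2 + 2 * D            ≤⟨ +-monoˡ-≤ (2 * D) (≤-trans 2≤D (m≤m+n D (D + 0))) ⟩
    2 * D + 2 * D        ≡⟨ lemma D ⟩
    4 * D                ≤⟨ *-mono-≤ {4} {40} (s≤s (s≤s (s≤s (s≤s z≤n)))) D≤t ⟩
    40 * t               ≤⟨ 40t≤n ⟩
    n                    ∎
    where
    lemma : ∀ D → 2 * D + 2 * D ≡ 4 * D
    lemma = solve-∀
    D≤t : D ≤ t
    D≤t = ≤-trans (m≤m*n D q) (≤-trans (m≤m*n W (W * W)) (m≤m*n (W * (W * W)) T))

  tests≤ : n * n + (n * n + suc (n + 2 * (n * D))) ≤ 2 ^ (6 * l)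
  tests≤ = begin
    n * n + (n * n + suc (n + 2 * (n * D)))        ≤⟨ +-monoʳ-≤ (n * n) (+-monoʳ-≤ (n * n) (+-monoˡ-≤ (n + 2 * (n * D)) (>-nonZero⁻¹ n))) ⟩
    n * n + (n * n + (n + (n + 2 * (n * D))))      ≡⟨ lemma n D ⟩
    2 * (n * n) + n * (2 + 2 * D)                  ≤⟨ +-monoʳ-≤ (2 * (n * n)) (*-monoʳ-≤ n 2+2D≤n) ⟩
    2 * (n * n) + n * n                            ≤⟨ m≤m+n _ (n * n) ⟩
    2 * (n * n) + n * n + n * n                    ≡⟨ lemma′ (n * n) ⟩
    4 * (n * n)                                    ≤⟨ 4nn≤ ⟩
    2 ^ (6 * l)                                    ∎
    where
    lemma : ∀ n D → n * n + (n * n + (n + (n + 2 * (n * D)))) ≡ 2 * (n * n) + n * (2 + 2 * D)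
    lemma = solve-∀
    lemma′ : ∀ x → 2 * x + x + x ≡ 4 * x
    lemma′ = solve-∀

  partition-tests≤ : suc n * 4 ≤ 2 ^ (6 * l)
  partition-tests≤ = begin
    suc n * 4       ≡⟨ *-comm (suc n) 4 ⟩
    4 * suc n       ≤⟨ *-monoʳ-≤ 4 (+-monoˡ-≤ n (>-nonZero⁻¹ n)) ⟩
    4 * (n + n)     ≤⟨ *-monoʳ-≤ 4 (≤-trans (≤-reflexive (lemma n)) (*-monoʳ-≤ n (m+n≤o⇒m≤o 2 2+2D≤n))) ⟩
    4 * (n * n)     ≤⟨ 4nn≤ ⟩
    2 ^ (6 * l)     ∎
    where
    lemma : ∀ n → n + n ≡ n * 2
    lemma = solve-∀

  open Partition (partition G W T (6 * l) M partition-tests≤ T-large)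
  open Links G kind

  R F : ℕ
  R = number isRelay
  F = number isFinal

  WT≤t : W * T ≤ t
  WT≤t = *-monoˡ-≤ T (m≤m*n W (W * W))
  WWT≤t : W * W * T ≤ t
  WWT≤t = *-monoˡ-≤ T (m≤n*m (W * W) W)
  WWW≤t : W * (W * W) ≤ t
  WWW≤t = m≤m*n (W * (W * W)) T
  WW≤t : W * W ≤ t
  WW≤t = ≤-trans (m≤n*m (W * W) W) WWW≤t
  W≤t : W ≤ t
  W≤t = ≤-trans (m≤m*n W (W * W)) WWW≤t
  D≤W : D ≤ W
  D≤W = m≤m*n D q
  WDT≤t : W * D * T ≤ t
  WDT≤t = ≤-trans (*-monoˡ-≤ T (*-monoʳ-≤ W D≤W)) WWT≤t
  WWDT≤t : W * W * D * T ≤ t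
  WWDT≤t = *-monoˡ-≤ T (≤-trans (*-monoʳ-≤ (W * W) D≤W) (≤-reflexive (*-comm (W * W) W)))

  n≤Ddeg : ∀ v → n ≤ D * degree G v
  n≤Ddeg v = m+n≤o⇒m≤o n (mindeg v)

  -- After multiplication by 8 W² D the two blocks cost 16 W³ (T + 1) ≤ 32 t and the sampling error
  -- costs 8 t: this is where 40 t is used up completely.
  toFinal : ∀ v → 2 * (q * suc T) ≤ degreeTo isFinal v
  toFinal v = *-cancelˡ-≤ (8 * (W * W) * D) {{m*n≢0 (8 * (W * W)) D {{m*n≢0 8 (W * W)}}}} (+-cancelʳ-≤ (8 * (W * W) * D * T) _ _ (begin
    8 * (W * W) * D * (2 * (q * suc T)) + 8 * (W * W) * D * T
      ≡⟨ lemma D q T ⟩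
    16 * (W * (W * W)) + (16 * t + 8 * (W * W * D * T))
      ≤⟨ +-mono-≤ (*-monoʳ-≤ 16 WWW≤t) (+-monoʳ-≤ (16 * t) (*-monoʳ-≤ 8 WWDT≤t)) ⟩
    16 * t + (16 * t + 8 * t)
      ≡⟨ forty t ⟩
    40 * t
      ≤⟨ 40t≤n ⟩
    n
      ≤⟨ n≤Ddeg v ⟩
    D * degree G v
      ≤⟨ *-monoʳ-≤ D (finals≥ v) ⟩
    D * (8 * (W * W) * degreeTo isFinal v + 8 * (W * W) * T)
      ≡⟨ lemma′ D (W * W) (degreeTo isFinal v) T ⟩
    8 * (W * W) * D * degreeTo isFinal v + 8 * (W * W) * D * T ∎))
    where
    lemma : ∀ D q T → let W = D * q in 8 * (W * W) * D * (2 * (q * suc T)) + 8 * (W * W) * D * T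
      ≡ 16 * (W * (W * W)) + (16 * (W * (W * W) * T) + 8 * (W * W * D * T))
    lemma = solve-∀
    lemma′ : ∀ D x d T → D * (8 * x * d + 8 * x * T) ≡ 8 * x * D * d + 8 * x * D * T
    lemma′ = solve-∀
    forty : ∀ t → 16 * t + (16 * t + 8 * t) ≡ 40 * t
    forty = solve-∀

  -- About n/(4WD) relay neighbours are guaranteed, twice the q F of about n/(8WD) that is required;
  -- the surplus absorbs the errors.
  toRelay : ∀ v → q * suc F ≤ degreeTo isRelay v
  toRelay v = *-cancelˡ-≤ (8 * (W * D)) {{m*n≢0 8 (W * D)}} (+-cancelʳ-≤ (8 * (W * D * T)) _ _ (begin
    8 * (W * D) * (q * suc F) + 8 * (W * D * T)
      ≡⟨ lemma D q F (W * D * T) ⟩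
    8 * (W * W) * F + (8 * (W * W) + 8 * (W * D * T))
      ≤⟨ +-mono-≤ finals≤ (+-mono-≤ (*-monoʳ-≤ 8 WW≤t) (*-monoʳ-≤ 8 WDT≤t)) ⟩
    n + 8 * (W * W) * T + (8 * t + 8 * t)
      ≡⟨ lemma₁ n (W * W) T t ⟩
    n + (8 * (W * W * T) + 16 * t)
      ≤⟨ +-monoʳ-≤ n (+-monoˡ-≤ (16 * t) (≤-trans (*-monoʳ-≤ 8 WWT≤t) (*-monoˡ-≤ t {8} {24} (m≤m+n 8 16)))) ⟩
    n + (24 * t + 16 * t)
      ≡⟨ cong (n +_) (forty t) ⟩
    n + 40 * t
      ≤⟨ +-monoʳ-≤ n 40t≤n ⟩
    n + n
      ≤⟨ +-mono-≤ (n≤Ddeg v) (n≤Ddeg v) ⟩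
    D * degree G v + D * degree G v
      ≤⟨ +-mono-≤ (*-monoʳ-≤ D (relays≥ v)) (*-monoʳ-≤ D (relays≥ v)) ⟩
    D * (4 * W * degreeTo isRelay v + 4 * W * T) + D * (4 * W * degreeTo isRelay v + 4 * W * T)
      ≡⟨ lemma′ D W (degreeTo isRelay v) T ⟩
    8 * (W * D) * degreeTo isRelay v + 8 * (W * D * T) ∎))
    where
    lemma : ∀ D q F x → let W = D * q in 8 * (W * D) * (q * suc F) + 8 * x ≡ 8 * (W * W) * F + (8 * (W * W) + 8 * x)
    lemma = solve-∀
    lemma₁ : ∀ n x T t → n + 8 * x * T + (8 * t + 8 * t) ≡ n + (8 * (x * T) + 16 * t)
    lemma₁ = solve-∀
    lemma′ : ∀ D W d T → D * (4 * W * d + 4 * W * T) + D * (4 * W * d + 4 * W * T) ≡ 8 * (W * D) * d + 8 * (W * D * T)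
    lemma′ = solve-∀
    forty : ∀ t → 24 * t + 16 * t ≡ 40 * t
    forty = solve-∀

  4WF≤ : 4 * W * F ≤ n + 8 * t
  4WF≤ = begin
    4 * W * F                  ≤⟨ *-monoˡ-≤ F (*-mono-≤ {4} {8} (m≤m+n 4 4) (m≤m*n W W)) ⟩
    8 * (W * W) * F            ≤⟨ finals≤ ⟩
    n + 8 * (W * W) * T        ≡⟨ cong (n +_) (*-assoc 8 (W * W) T) ⟩
    n + 8 * (W * W * T)        ≤⟨ +-monoʳ-≤ n (*-monoʳ-≤ 8 WWT≤t) ⟩
    n + 8 * t                  ∎

  4WR≤ : 4 * W * R ≤ n + 4 * t
  4WR≤ = ≤-trans relays≤ (+-monoʳ-≤ n (≤-trans (≤-reflexive (*-assoc 4 W T)) (*-monoʳ-≤ 4 WT≤t)))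

  degree≥ : ∀ v → F + q + q * R ≤ degree G v
  degree≥ v = *-cancelˡ-≤ D (*-cancelˡ-≤ 4 (begin
    4 * (D * (F + q + q * R))
      ≡⟨ lemma D q F R ⟩
    4 * D * F + (4 * W + 4 * W * R)
      ≤⟨ +-mono-≤ (≤-trans (*-monoˡ-≤ F (*-monoʳ-≤ 4 D≤W)) 4WF≤) (+-mono-≤ (*-monoʳ-≤ 4 W≤t) 4WR≤) ⟩
    n + 8 * t + (4 * t + (n + 4 * t))
      ≤⟨ m≤m+n _ (24 * t) ⟩
    n + 8 * t + (4 * t + (n + 4 * t)) + 24 * t
      ≡⟨ lemma′ n t ⟩
    2 * n + 40 * t
      ≤⟨ +-monoʳ-≤ (2 * n) (≤-trans 40t≤n (m≤m+n n n)) ⟩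
    2 * n + (n + n)
      ≡⟨ four n ⟩
    4 * n
      ≤⟨ *-monoʳ-≤ 4 (n≤Ddeg v) ⟩
    4 * (D * degree G v) ∎))
    where
    lemma : ∀ D q F R → 4 * (D * (F + q + q * R)) ≡ 4 * D * F + (4 * (D * q) + 4 * (D * q) * R)
    lemma = solve-∀
    lemma′ : ∀ n t → n + 8 * t + (4 * t + (n + 4 * t)) + 24 * t ≡ 2 * n + 40 * t
    lemma′ = solve-∀
    four : ∀ n → 2 * n + (n + n) ≡ 4 * n
    four = solve-∀

  -- `reserve` bounds the loss in D times the degree when only main neighbours are kept. It is at
  -- most n/q, a small part of the surplus a.
  reserve p : ℕ
  reserve = D * (R + F)
  p = n + a ∸ reserve

  q-reserve≤n : q * reserve ≤ n
  q-reserve≤n = *-cancelˡ-≤ 4 (begin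
    4 * (q * (D * (R + F)))          ≡⟨ lemma D q R F ⟩
    4 * W * R + 4 * W * F            ≤⟨ +-mono-≤ 4WR≤ 4WF≤ ⟩
    n + 4 * t + (n + 8 * t)          ≤⟨ m≤m+n _ (28 * t) ⟩
    n + 4 * t + (n + 8 * t) + 28 * t ≡⟨ lemma′ n t ⟩
    2 * n + 40 * t                   ≤⟨ +-monoʳ-≤ (2 * n) (≤-trans 40t≤n (m≤m+n n n)) ⟩
    2 * n + (n + n)                  ≡⟨ four n ⟩
    4 * n                            ∎)
    where
    lemma : ∀ D q R F → 4 * (q * (D * (R + F))) ≡ 4 * (D * q) * R + 4 * (D * q) * F
    lemma = solve-∀
    lemma′ : ∀ n t → n + 4 * t + (n + 8 * t) + 28 * t ≡ 2 * n + 40 * t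
    lemma′ = solve-∀
    four : ∀ n → 2 * n + (n + n) ≡ 4 * n
    four = solve-∀

  reserve≤a : reserve ≤ a
  reserve≤a = *-cancelˡ-≤ q (≤-trans q-reserve≤n (≤-trans (m≤m+n n (6 * D * n)) a-large))

  p+reserve : p + reserve ≡ n + a
  p+reserve = m∸n+n≡m (≤-trans reserve≤a (m≤n+m a n))

  n≤p : n ≤ p
  n≤p = +-cancelʳ-≤ reserve n p (≤-trans (+-monoʳ-≤ n reserve≤a) (≤-reflexive (≡.sym p+reserve)))

  toMain : ∀ v → p ≤ D * degreeTo isMain v
  toMain v = +-cancelʳ-≤ reserve _ _ (begin
    p + reserve                              ≡⟨ p+reserve ⟩
    n + a                                    ≤⟨ mindeg v ⟩
    D * degree G v                           ≤⟨ *-monoʳ-≤ D (degree-split G kind v) ⟩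
    D * (degreeTo isMain v + (R + F))        ≡⟨ *-distribˡ-+ D (degreeTo isMain v) (R + F) ⟩
    D * degreeTo isMain v + reserve          ∎)

  q-p : q * n + 6 * D * n ≤ q * p
  q-p = +-cancelʳ-≤ n _ _ (begin
    q * n + 6 * D * n + n           ≡⟨ lemma q n D ⟩
    q * n + (1 + 6 * D) * n         ≤⟨ +-monoʳ-≤ (q * n) a-large ⟩
    q * n + q * a                   ≡⟨ *-distribˡ-+ q n a ⟨
    q * (n + a)                     ≡⟨ cong (q *_) p+reserve ⟨
    q * (p + reserve)               ≡⟨ *-distribˡ-+ q p reserve ⟩
    q * p + q * reserve             ≤⟨ +-monoʳ-≤ (q * p) q-reserve≤n ⟩
    q * p + n                       ∎)
    where
    lemma : ∀ q n D → q * n + 6 * D * n + n ≡ q * n + (1 + 6 * D) * n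
    lemma = solve-∀

  -- Adding the three reserved residues to both sides turns q′ into q on the right and leaves 4 p (T
  -- + 1) on the left. With p ≤ D n this is 4 D n (T + 1); the blurring 2 D T of the levels
  -- contributes 2 D more, whence the 6 D in `q-p`.
  density : n * (q * suc T + 2 * (D * T)) + p + p * T ≤ p * (suc T * q′)
  density = +-cancelʳ-≤ (3 * p * suc T) _ _ (begin
    n * (q * suc T + 2 * (D * T)) + p + p * T + 3 * p * suc T
      ≡⟨ lemma n q T D p ⟩
    q * n * suc T + (2 * D * n * T + 4 * suc T * p)
      ≤⟨ +-monoʳ-≤ (q * n * suc T) (+-mono-≤ (*-monoʳ-≤ (2 * D * n) (n≤1+n T)) (*-monoʳ-≤ (4 * suc T) (≤-trans (m∸n≤m (n + a) reserve) na≤Dn))) ⟩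
    q * n * suc T + (2 * D * n * suc T + 4 * suc T * (D * n))
      ≡⟨ lemma₁ q n T D ⟩
    (q * n + 6 * D * n) * suc T
      ≤⟨ *-monoˡ-≤ (suc T) q-p ⟩
    q * p * suc T
      ≡⟨ lemma₂ q′ p T ⟩
    p * (suc T * q′) + 3 * p * suc T ∎)
    where
    lemma : ∀ n q T D p → n * (q * suc T + 2 * (D * T)) + p + p * T + 3 * p * suc T ≡ q * n * suc T + (2 * D * n * T + 4 * suc T * p)
    lemma = solve-∀
    lemma₁ : ∀ q n T D → q * n * suc T + (2 * D * n * suc T + 4 * suc T * (D * n)) ≡ (q * n + 6 * D * n) * suc T
    lemma₁ = solve-∀
    lemma₂ : ∀ q′ p T → (3 + q′) * p * suc T ≡ p * (suc T * q′) + 3 * p * suc T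
    lemma₂ = solve-∀

-- From the degree hypothesis to the parameters.

minFin-≤ : ∀ {n} (f : Fin n → ℕ) i → minFin f ≤ f i
minFin-≤ {suc zero}    f zero    = ≤-refl
minFin-≤ {suc (suc n)} f zero    = m⊓n≤m _ _
minFin-≤ {suc (suc n)} f (suc i) = ≤-trans (m⊓n≤n (f zero) _) (minFin-≤ (f ∘ suc) i)

2^-cancel-≤ : ∀ x y → 2 ^ x ≤ 2 ^ y → x ≤ y
2^-cancel-≤ x y le with x ≤? y
... | yes x≤y = x≤y
... | no  x≰y = contradiction (≤-trans (^-monoʳ-< 2 (s≤s (s≤s z≤n)) (≰⇒> x≰y)) le) (<-irrefl refl)

-- Multiplying the hypothesis by q^6 and inserting q a ≤ c₀ D n cancels (c₀ D)^6 n^5 and leaves c₁^6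
-- l q^6 ≤ 2 n. The factor 2 is absorbed by 2 c₁ ≤ c₁^6.
large-order : ∀ D c₀ c₁ n l q a → {{NonZero D}} → {{NonZero c₀}} → {{NonZero n}} → 2 ≤ c₁ →
  l * ((D * (c₀ * c₁)) ^ 6 * n ^ 5) ≤ 2 * a ^ 6 → q * a ≤ c₀ * (D * n) → c₁ * (l * q ^ 6) ≤ n
large-order D c₀ c₁@(suc c) n l q a 2≤c₁ la≤ qa≤ = *-cancelˡ-≤ f (begin
  f * (c₁ * (l * q ^ 6))
    ≡⟨ lemma₁ ((c₀ * D) ^ 6) (n ^ 5) c₁ (l * q ^ 6) ⟩
  (c₀ * D) ^ 6 * n ^ 5 * (l * q ^ 6) * (2 * c₁)
    ≤⟨ *-monoʳ-≤ ((c₀ * D) ^ 6 * n ^ 5 * (l * q ^ 6)) sixth ⟩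
  (c₀ * D) ^ 6 * n ^ 5 * (l * q ^ 6) * c₁ ^ 6
    ≡⟨ lemma₂ ((c₀ * D) ^ 6) (n ^ 5) l (q ^ 6) (c₁ ^ 6) ⟩
  l * ((c₀ * D) ^ 6 * c₁ ^ 6 * n ^ 5) * q ^ 6
    ≡⟨ cong (λ x → l * (x * n ^ 5) * q ^ 6) (trans (≡.sym (^-distribʳ-* (c₀ * D) c₁ 6)) (cong (_^ 6) (lemma₃ c₀ D c₁))) ⟩
  l * ((D * (c₀ * c₁)) ^ 6 * n ^ 5) * q ^ 6
    ≤⟨ *-monoˡ-≤ (q ^ 6) la≤ ⟩
  2 * a ^ 6 * q ^ 6
    ≡⟨ trans (lemma₄ (a ^ 6) (q ^ 6)) (cong (2 *_) (≡.sym (^-distribʳ-* q a 6))) ⟩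
  2 * (q * a) ^ 6
    ≤⟨ *-monoʳ-≤ 2 (^-monoˡ-≤ 6 qa≤) ⟩
  2 * (c₀ * (D * n)) ^ 6
    ≡⟨ cong (2 *_) (trans (cong (_^ 6) (≡.sym (*-assoc c₀ D n))) (^-distribʳ-* (c₀ * D) n 6)) ⟩
  2 * ((c₀ * D) ^ 6 * (n * n ^ 5))
    ≡⟨ lemma₅ ((c₀ * D) ^ 6) n (n ^ 5) ⟩
  f * n ∎)
  where
  open ≤-Reasoning
  f : ℕ
  f = 2 * ((c₀ * D) ^ 6 * n ^ 5)
  instance
    f≢0 : NonZero f
    f≢0 = m*n≢0 2 ((c₀ * D) ^ 6 * n ^ 5) {{_}} {{m*n≢0 ((c₀ * D) ^ 6) (n ^ 5) {{m^n≢0 (c₀ * D) 6 {{m*n≢0 c₀ D}}}} {{m^n≢0 n 5}}}}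
  sixth : 2 * c₁ ≤ c₁ ^ 6
  sixth = begin
    2 * c₁          ≤⟨ *-monoˡ-≤ c₁ 2≤c₁ ⟩
    c₁ * c₁         ≡⟨ cong (c₁ *_) (*-identityʳ c₁) ⟨
    c₁ ^ 2          ≤⟨ ^-monoʳ-≤ c₁ {2} {6} (s≤s (s≤s z≤n)) ⟩
    c₁ ^ 6          ∎
  lemma₁ : ∀ x y c z → 2 * (x * y) * (c * z) ≡ x * y * z * (2 * c)
  lemma₁ = solve-∀
  lemma₂ : ∀ x y l z c → x * y * (l * z) * c ≡ l * (x * c * y) * z
  lemma₂ = solve-∀
  lemma₃ : ∀ c D c′ → c * D * c′ ≡ D * (c * c′)
  lemma₃ = solve-∀
  lemma₄ : ∀ x y → 2 * x * y ≡ 2 * (y * x)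
  lemma₄ = solve-∀
  lemma₅ : ∀ x n y → 2 * (x * (n * y)) ≡ 2 * (x * y) * n
  lemma₅ = solve-∀

exponent-bound : ∀ n l x p → 2 ^ l ≤ n → LeExp (n ^ x) p → l * x ≤ 2 * p
exponent-bound n l x p ≤n le = 2^-cancel-≤ _ _ (begin
  2 ^ (l * x)    ≡⟨ ^-*-assoc 2 l x ⟨
  (2 ^ l) ^ x    ≤⟨ ^-monoˡ-≤ x ≤n ⟩
  n ^ x          ≤⟨ LeExp⇒≤2^ le ⟩
  2 ^ (2 * p)    ∎)
  where open ≤-Reasoning

dense-irregular : ∀ {n} (G : Graph n) D q l a {{_ : NonZero n}} → 2 ≤ D → 4 ≤ q → 1 ≤ l → n ≤ 2 ^ suc l →
  (∀ v → n + a ≤ D * degree G v) → n + a ≤ D * n → (1 + 6 * D) * n ≤ q * a →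
  24 * (80 * (D * D * D) * (80 * (D * D * D))) * (l * q ^ 6) ≤ n → IrrStrengthAtMost G (suc D)
dense-irregular {suc n} G D (suc (suc (suc (suc o)))) l a 2≤D (s≤s (s≤s (s≤s (s≤s z≤n)))) 1≤l n≤ mindeg na≤ a-large n-large =
  -- q ≥ 4 makes q′ = o + 1 positive. X = 80 D³ q³ is 80 W³ exactly, and X² produces the sixth power
  -- of q in the hypothesis.
  Construction.irregular G D (parameters G D (suc o) (E * (q * (q * q))) l a 2≤D 1≤l n≤ mindeg na≤ a-large
    (≤-reflexive (cube D q)) (≤-trans (≤-reflexive (square E l q)) n-large))
  where
  q E : ℕ
  q = 4 + o
  E = 80 * (D * D * D)
  cube : ∀ D q → 80 * (D * q * (D * q * (D * q))) ≡ 80 * (D * D * D) * (q * (q * q))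
  cube = solve-∀
  square : ∀ E l q → 24 * (l * (E * (q * (q * q)) * (E * (q * (q * q))))) ≡ 24 * (E * E) * (l * (q * (q * (q * (q * (q * (q * 1)))))))
  square = solve-∀

scale-lower : ∀ c n a {{_ : NonZero a}} → c * n ≤ c * suc (n / a) * a
scale-lower c n a = begin
  c * n                          ≡⟨ cong (c *_) (m≡m%n+[m/n]*n n a) ⟩
  c * (n % a + n / a * a)        ≤⟨ *-monoʳ-≤ c (+-monoˡ-≤ (n / a * a) (m%n≤n n a)) ⟩
  c * (suc (n / a) * a)          ≡⟨ *-assoc c (suc (n / a)) a ⟨
  c * suc (n / a) * a            ∎
  where open ≤-Reasoning

scale-upper : ∀ c n a x {{_ : NonZero a}} → n + a ≤ x → c * suc (n / a) * a ≤ c * x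
scale-upper c n a x n+a≤x = begin
  c * suc (n / a) * a            ≡⟨ *-assoc c (suc (n / a)) a ⟩
  c * (a + n / a * a)            ≤⟨ *-monoʳ-≤ c (+-monoʳ-≤ a (m/n*n≤m n a)) ⟩
  c * (a + n)                    ≡⟨ cong (c *_) (+-comm a n) ⟩
  c * (n + a)                    ≤⟨ *-monoʳ-≤ c n+a≤x ⟩
  c * x                          ∎
  where open ≤-Reasoning

degree-condition : ∀ {n} (G : Graph n) D c₀ c₁ {{_ : NonZero n}} → 2 ≤ D → 2 ≤ n → 1 + 6 * D ≤ c₀ →
  24 * (80 * (D * D * D) * (80 * (D * D * D))) ≤ c₁ →
  MinDegreeCondition (suc D) (c₀ * c₁) n (minDegree G) → IrrStrengthAtMost G (suc D)
degree-condition {n} G D c₀ c₁ 2≤D 2≤n ≤c₀ ≤c₁ (n≤δD , le) with power-of-two-bracket n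
... | l , 2^l≤n , n<2^ = dense-irregular G D q l a 2≤D 4≤q 1≤l (<⇒≤ n<2^) mindeg na≤Dn
    (≤-trans (*-monoˡ-≤ n ≤c₀) (scale-lower c₀ n a))
    (≤-trans (*-monoˡ-≤ (l * q ^ 6) ≤c₁)
      (large-order D c₀ c₁ n l q a 2≤c₁ la≤ (scale-upper c₀ n a (D * n) na≤Dn)))
  where
  open ≤-Reasoning
  δ a q : ℕ
  δ = minDegree G
  a = δ * D ∸ n
  2≤c₁ : 2 ≤ c₁
  2≤c₁ = ≤-trans (*-mono-≤ {2} {24} {1} (s≤s (s≤s z≤n)) (>-nonZero⁻¹ (E * E))) ≤c₁
    where
    E : ℕ
    E = 80 * (D * D * D)
    instance
      D≢0 : NonZero D
      D≢0 = >-nonZero (≤-trans (s≤s z≤n) 2≤D)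
      D*D≢0 : NonZero (D * D)
      D*D≢0 = m*n≢0 D D
      D*D*D≢0 : NonZero (D * D * D)
      D*D*D≢0 = m*n≢0 (D * D) D
      E≢0 : NonZero E
      E≢0 = m*n≢0 80 (D * D * D)
      E*E≢0 : NonZero (E * E)
      E*E≢0 = m*n≢0 E E
  instance
    D≢0 : NonZero D
    D≢0 = >-nonZero (≤-trans (s≤s z≤n) 2≤D)
    c₀≢0 : NonZero c₀
    c₀≢0 = >-nonZero (≤-trans (s≤s z≤n) ≤c₀)
    c₁≢0 : NonZero c₁
    c₁≢0 = >-nonZero (≤-trans (s≤s z≤n) 2≤c₁)
  1≤l : 1 ≤ l
  1≤l = nonzero l n<2^
    where
    nonzero : ∀ l → n < 2 ^ suc l → 1 ≤ l
    nonzero zero    n<2 = contradiction (≤-trans n<2 2≤n) (<-irrefl refl)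
    nonzero (suc l) _   = s≤s z≤n
  la≤ : l * ((D * (c₀ * c₁)) ^ 6 * n ^ 5) ≤ 2 * a ^ 6
  la≤ = exponent-bound n l ((D * (c₀ * c₁)) ^ 6 * n ^ 5) (a ^ 6) 2^l≤n le
  instance
    -- For a = 0 the right side of `la≤` is 0, while its left side is positive as n ≥ 2 forces l ≥
    -- 1.
    a≢0 : NonZero a
    a≢0 = ≢-nonZero λ a≡0 → contradiction (≤-trans positive (≤-trans la≤ (≤-reflexive (cong (λ x → 2 * x ^ 6) a≡0)))) λ ()
      where
      positive : 1 ≤ l * ((D * (c₀ * c₁)) ^ 6 * n ^ 5)
      positive = >-nonZero⁻¹ _ {{m*n≢0 l _ {{>-nonZero 1≤l}} {{m*n≢0 ((D * (c₀ * c₁)) ^ 6) (n ^ 5)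
        {{m^n≢0 (D * (c₀ * c₁)) 6 {{m*n≢0 D (c₀ * c₁) {{D≢0}} {{m*n≢0 c₀ c₁}}}}}} {{m^n≢0 n 5}}}}}}
  -- Rounding n/a up gives c₀ n ≤ q a, and the rounding adds at most a, so that q a ≤ c₀ (n + a) ≤
  -- c₀ D n.
  q = c₀ * suc (n / a)
  n+a≡δD : n + a ≡ δ * D
  n+a≡δD = m+[n∸m]≡n n≤δD
  mindeg : ∀ v → n + a ≤ D * degree G v
  mindeg v = ≤-trans (≤-reflexive (trans n+a≡δD (*-comm δ D))) (*-monoʳ-≤ D (minFin-≤ (degree G) v))
  na≤Dn : n + a ≤ D * n
  na≤Dn = ≤-trans (mindeg (first n)) (*-monoʳ-≤ D (count≤ (adj G (first n))))
    where
    first : ∀ n {{_ : NonZero n}} → Fin n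
    first (suc n) = zero
  4≤q : 4 ≤ q
  4≤q = begin
    4                  ≤⟨ m≤m+n 4 9 ⟩
    1 + 6 * 2          ≤⟨ +-monoʳ-≤ 1 (*-monoʳ-≤ 6 2≤D) ⟩
    1 + 6 * D          ≤⟨ ≤c₀ ⟩
    c₀                 ≤⟨ m≤m*n c₀ (suc (n / a)) ⟩
    q                  ∎

theorem3 : (K : ℕ) → 3 ≤ K →
    ∃ λ (C : ℕ) → ∀ (n : ℕ) → 2 ≤ n → (G : Graph n) →
    MinDegreeCondition K C n (minDegree G) → IrrStrengthAtMost G K
-- C is the product of c₀ = 1 + 6 D, which scales q against n/a, and c₁ = 24 (80 D³)², the constant
-- of 24 l X² ≤ n.
theorem3 (suc D) (s≤s 2≤D) = (1 + 6 * D) * (24 * (80 * (D * D * D) * (80 * (D * D * D)))) , λ n 2≤n G →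
  degree-condition G D (1 + 6 * D) (24 * (80 * (D * D * D) * (80 * (D * D * D))))
    {{>-nonZero (≤-trans (s≤s z≤n) 2≤n)}} 2≤D 2≤n (≤-refl {1 + 6 * D})
    (≤-refl {24 * (80 * (D * D * D) * (80 * (D * D * D)))})
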